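{- Let $d\ge 2$ and let $D$ be a fixed $d$-ary tree with at least two leaves, with branches $D_1,D_2,\ldots,D_d$ (some of them possibly empty). Then $$I_d(D)\le\binom{\|D\|}{\|D_1\|,\|D_2\|,\ldots,\|D_d\|}\Big(\prod_{i=1}^d I_d(D_i)\Big)\sup_{\substack{0\le x_1,x_2,\ldots,x_d<1\\ x_1+x_2+\cdots+x_d=1}}Z_D(x_1,x_2,\ldots,x_d),$$ where $$Z_D(x_1,x_2,\ldots,x_d)=\frac{1}{1-\sum_{i=1}^d x_i^{\|D\|}}\sum_{\pi\in M(D)}\ \prod_{j=1}^d x_j^{\|D_{\pi(j)}\|}.$$
   Context: A $d$-ary tree is a finite rooted tree in which every internal (non-leaf) vertex has at least two and at most $d$ children; a single vertex is a $d$-ary tree with one leaf, and the empty tree with $0$ leaves is also allowed. Isomorphism means root-preserving isomorphism (two empty trees are isomorphic). $\|T\|$ denotes the number of leaves of $T$. A set $S$ of leaves of $T$ induces a $d$-ary tree: take the smallest subtree of $T$ containing all leaves in $S$ (rooted at the most recent common ancestor of $S$) and repeatedly suppress every vertex with exactly one child (contracting its two adjacent edges to a single edge). $c(D,T)$ is the number of sets of $\|D\|$ leaves of $T$ that induce a tree isomorphic to $D$, and $\gamma(D,T)=c(D,T)/\binom{\|T\|}{\|D\|}$. The $d$-ary inducibility of a nonempty $d$-ary tree $D$ is $$I_d(D)=\limsup_{n\to\infty}\ \max_{\substack{\|T\|=n\\ T\ d\text{ -ary tree}}}\gamma(D,T),$$ and $I_d(D)=1$ if $D$ is empty. The branches of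 a $d$-ary tree $D$ with at least two leaves are the components (rooted at the children of the root) obtained on removing the root; the list is padded with empty trees to have exactly $d$ entries $D_1,\ldots,D_d$. On the set of permutations of $[d]=\{1,\ldots,d\}$ define $\pi\sim_D\pi'$ if $D_{\pi(j)}$ is isomorphic to $D_{\pi'(j)}$ for every $j\in[d]$; $M(D)$ is a complete set of representatives of the equivalence classes of $\sim_D$. The convention $0^0=1$ is used. -}

module Defs where

open import Algebra.Bundles.Raw using (RawMonoid; RawRing)
import Algebra.Definitions.RawMonoid as RawMonoidOps
import Algebra.Definitions.RawSemiring as RawSemiringOps
open import Data.Fin.Base using (Fin; zero; suc; punchIn)
open import Data.Fin.Permutation as Perm
  using (Permutation; Permutation′; _⟨$⟩ʳ_; _⟨$⟩ˡ_)
import Data.Fin.Properties as Fin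
open import Data.Fin.Subset using (Subset; inside; outside; ∣_∣)
import Data.Integer.Base as ℤ
open import Data.List.Base as List using (List; []; _∷_; filter; length; lookup)
open import Data.List.Relation.Unary.AllPairs using (AllPairs)
open import Data.List.Relation.Unary.Any using (Any)
open import Data.Maybe.Base using (Maybe; just; nothing)
import Data.Maybe.Relation.Binary.Pointwise as Maybe
open import Data.Nat.Base as ℕ using (ℕ; zero; suc; z≤n; s≤s; NonZero; _!)
open import Data.Nat.Combinatorics using (_C_)
import Data.Nat.Properties as ℕ
open import Data.Product.Base using (Σ; ∃; _×_; _,_; proj₁; proj₂)
open import Data.Rational.Base as ℚ
  using (ℚ; 0ℚ; 1ℚ; ½; _+_; _*_; -_; _-_; _≤_; _<_)
import Data.Rational.Properties as ℚ
open import Data.Rational.Solver using (module +-*-Solver)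
open import Data.Sum.Base using (inj₁; inj₂)
open import Data.Vec.Base as Vec using (take; drop)
open import Function.Base using (_∘_)
open import Level using (0ℓ)
open import Relation.Binary.PropositionalEquality
  using (_≡_; refl; sym; trans; cong; cong₂; subst; subst₂)
open import Relation.Nullary using (¬_; Dec; yes; no; contradiction)
open import Relation.Nullary.Decidable using (map′; _×-dec_)

-- Children are listed in some order; `_≅_` below disregards that order.
data NonemptyTree (d : ℕ) : Set where
  leaf : NonemptyTree d
  node : (ts : List (NonemptyTree d)) → 2 ℕ.≤ length ts → length ts ℕ.≤ d →
         NonemptyTree d

Tree : ℕ → Set
Tree d = Maybe (NonemptyTree d)

pattern empty = nothing

module _ {d : ℕ} where

  leaves  : NonemptyTree d → ℕ
  leaves* : List (NonemptyTree d) → ℕ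
  leaves leaf          = 1
  leaves (node ts _ _) = leaves* ts
  leaves* []       = 0
  leaves* (t ∷ ts) = leaves t ℕ.+ leaves* ts

  ‖_‖ : Tree d → ℕ
  ‖ empty  ‖ = 0
  ‖ just t ‖ = leaves t

  infix 4 _≅⁺_ _≅_

  data _≅⁺_ : NonemptyTree d → NonemptyTree d → Set where
    leaf : leaf ≅⁺ leaf
    node : ∀ {ts us p q p′ q′} (σ : Permutation (length ts) (length us)) →
           (∀ i → lookup ts i ≅⁺ lookup us (σ ⟨$⟩ʳ i)) →
           node ts p q ≅⁺ node us p′ q′

  _≅_ : Tree d → Tree d → Set
  _≅_ = Maybe.Pointwise _≅⁺_

-- Backtracking search for a bijection whose graph lies in a decidable relation.
matching? : ∀ {m n} {R : Fin m → Fin n → Set} → (∀ i j → Dec (R i j)) →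
            Dec (Σ (Permutation m n) λ σ → ∀ i → R i (σ ⟨$⟩ʳ i))
matching? {zero}  {zero}  R? = yes (Perm.id , λ ())
matching? {zero}  {suc n} R? = no λ { (σ , _) → contradiction (σ ⟨$⟩ˡ zero) λ () }
matching? {suc m} {zero}  R? = no λ { (σ , _) → contradiction (σ ⟨$⟩ʳ zero) λ () }
matching? {suc m} {suc n} {R} R? = map′ extend restrict
  (Fin.any? λ j → R? zero j ×-dec matching? (λ i k → R? (suc i) (punchIn j k)))
  where
  Rest : Fin (suc n) → Set
  Rest j = Σ (Permutation m n) λ σ → ∀ i → R (suc i) (punchIn j (σ ⟨$⟩ʳ i))

  extend : (∃ λ j → R zero j × Rest j) →
           Σ (Permutation (suc m) (suc n)) λ σ → ∀ i → R i (σ ⟨$⟩ʳ i)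
  extend (j , r , σ , rs) = Perm.insert zero j σ , λ where
    zero    → r
    (suc i) → subst (R (suc i)) (sym (Perm.insert-punchIn zero j σ i)) (rs i)

  restrict : (Σ (Permutation (suc m) (suc n)) λ σ → ∀ i → R i (σ ⟨$⟩ʳ i)) →
             ∃ λ j → R zero j × Rest j
  restrict (σ , rs) = σ ⟨$⟩ʳ zero , rs zero , Perm.remove zero σ ,
    λ i → subst (R (suc i)) (Perm.punchIn-permute σ zero i) (rs (suc i))

module _ {d : ℕ} where

  infix 4 _≅⁺?_ _≅?_

  _≅⁺?_ : (t u : NonemptyTree d) → Dec (t ≅⁺ u)
  pairs? : (ts us : List (NonemptyTree d)) → ∀ i j → Dec (lookup ts i ≅⁺ lookup us j)
  leaf        ≅⁺? leaf        = yes leaf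
  leaf        ≅⁺? node _ _ _  = no λ ()
  node _ _ _  ≅⁺? leaf        = no λ ()
  node ts _ _ ≅⁺? node us _ _ =
    map′ (λ (σ , f) → node σ f) (λ { (node σ f) → σ , f }) (matching? (pairs? ts us))
  pairs? (t ∷ ts) us zero    j = t ≅⁺? lookup us j
  pairs? (t ∷ ts) us (suc i) j = pairs? ts us i j

  _≅?_ : (T U : Tree d) → Dec (T ≅ U)
  _≅?_ = Maybe.dec _≅⁺?_

  -- The tree whose root branches are the given ones; a root with a single
  -- child is suppressed.
  graft : (us : List (NonemptyTree d)) → length us ℕ.≤ d → Tree d
  graft []              _ = empty
  graft (u ∷ [])        _ = just u
  graft us@(_ ∷ _ ∷ _)  p = just (node us (s≤s (s≤s z≤n)) p)

  -- The tree induced by a set of leaves.  Leaves are numbered from left to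
  -- right.  Branches without chosen leaves are pruned, and every vertex that
  -- is left with one child is suppressed (in particular those above the most
  -- recent common ancestor of the chosen leaves).
  induced⁺ : (t : NonemptyTree d) → Subset (leaves t) → Tree d
  induced* : (ts : List (NonemptyTree d)) → Subset (leaves* ts) →
             Σ (List (NonemptyTree d)) λ us → length us ℕ.≤ length ts
  induced⁺ leaf (outside Vec.∷ Vec.[]) = empty
  induced⁺ leaf (inside  Vec.∷ Vec.[]) = just leaf
  induced⁺ (node ts _ ts≤d) S =
    let us , us≤ts = induced* ts S in graft us (ℕ.≤-trans us≤ts ts≤d)
  induced* []       _ = [] , z≤n
  induced* (t ∷ ts) S with induced⁺ t (take (leaves t) S) | induced* ts (drop (leaves t) S)
  ... | empty  | us , p = us , ℕ.m≤n⇒m≤1+n p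
  ... | just u | us , p = u ∷ us , s≤s p

  induced : (T : Tree d) → Subset ‖ T ‖ → Tree d
  induced empty    _ = empty
  induced (just t) S = induced⁺ t S

  subsets : ∀ n → List (Subset n)
  subsets zero    = Vec.[] ∷ []
  subsets (suc n) = List.map (outside Vec.∷_) (subsets n) List.++
                    List.map (inside  Vec.∷_) (subsets n)

  copies : Tree d → Tree d → ℕ
  copies D T = length
    (filter (λ S → (∣ S ∣ ℕ.≟ ‖ D ‖) ×-dec (induced T S ≅? D)) (subsets ‖ T ‖))

  -- The value 0 when ‖ T ‖ < ‖ D ‖ is a convention.
  density : Tree d → Tree d → ℚ
  density D T with ‖ T ‖ C ‖ D ‖
  ... | zero      = 0ℚ
  ... | b@(suc _) = ℤ.+ copies D T ℚ./ b

  padded : {A : Set} {n : ℕ} → List A → Fin n → Maybe A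
  padded []       _       = nothing
  padded (x ∷ xs) zero    = just x
  padded (x ∷ xs) (suc i) = padded xs i

  branches : Tree d → Fin d → Tree d
  branches (just (node ts _ _)) i = padded ts i
  branches (just leaf)          _ = empty
  branches empty                _ = empty

  infix 4 _∼[_]_

  _∼[_]_ : Permutation′ d → Tree d → Permutation′ d → Set
  π ∼[ D ] π′ = ∀ j → branches D (π ⟨$⟩ʳ j) ≅ branches D (π′ ⟨$⟩ʳ j)

  record Representatives (D : Tree d) : Set where
    field
      list       : List (Permutation′ d)
      distinct   : AllPairs (λ π π′ → ¬ π ∼[ D ] π′) list
      exhaustive : ∀ π → Any (π ∼[ D ]_) list

open RawSemiringOps ℕ.+-*-rawSemiring using () renaming (product to ℕ-product)

product-nonZero : ∀ {n} (f : Fin n → ℕ) → (∀ i → NonZero (f i)) → NonZero (ℕ-product f)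
product-nonZero {zero}  f f≢0 = _
product-nonZero {suc n} f f≢0 =
  ℕ.m*n≢0 _ _ {{f≢0 zero}} {{product-nonZero (f ∘ suc) (f≢0 ∘ suc)}}

multinomial : ∀ {r} → ℕ → (Fin r → ℕ) → ℚ
multinomial n k =
  ℚ._/_ (ℤ.+ (n !)) (ℕ-product (λ i → k i !)) {{product-nonZero _ (λ i → k i ℕ.!≢0)}}

open +-*-Solver using (solve; _:=_; _:+_; _:*_; _:-_; :-_)

0≤+ : ∀ {p q} → 0ℚ ≤ p → 0ℚ ≤ q → 0ℚ ≤ p + q
0≤+ = ℚ.+-mono-≤

0≤* : ∀ {p q} → 0ℚ ≤ p → 0ℚ ≤ q → 0ℚ ≤ p * q
0≤* {p} {q} 0≤p 0≤q = ℚ.nonNegative⁻¹ (p * q)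
  {{ℚ.nonNeg*nonNeg⇒nonNeg p {{ℚ.nonNegative 0≤p}} q {{ℚ.nonNegative 0≤q}}}}

0<* : ∀ {p q} → 0ℚ < p → 0ℚ < q → 0ℚ < p * q
0<* {p} {q} 0<p 0<q = ℚ.positive⁻¹ (p * q)
  {{ℚ.pos*pos⇒pos p {{ℚ.positive 0<p}} q {{ℚ.positive 0<q}}}}

0≤q-p : ∀ {p q} → p ≤ q → 0ℚ ≤ q - p
0≤q-p {p} {q} p≤q = subst (_≤ q - p) (ℚ.+-inverseʳ p) (ℚ.+-monoˡ-≤ (- p) p≤q)

0<q-p : ∀ {p q} → p < q → 0ℚ < q - p
0<q-p {p} {q} p<q = subst (_< q - p) (ℚ.+-inverseʳ p) (ℚ.+-monoˡ-< (- p) p<q)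

≤-by : ∀ {p q} r → 0ℚ ≤ r → p + r ≡ q → p ≤ q
≤-by {p} r 0≤r eq = subst₂ _≤_ (ℚ.+-identityʳ p) eq (ℚ.+-monoʳ-≤ p 0≤r)

<-by : ∀ {p q} r → 0ℚ < r → p + r ≡ q → p < q
<-by {p} r 0<r eq = subst₂ _<_ (ℚ.+-identityʳ p) eq (ℚ.+-monoʳ-< p 0<r)

*-mono : ∀ {p q r s} → 0ℚ ≤ p → p ≤ q → 0ℚ ≤ r → r ≤ s → p * r ≤ q * s
*-mono {p} {q} {r} {s} 0≤p p≤q 0≤r r≤s = ≤-by
  ((q - p) * s + p * (s - r))
  (0≤+ (0≤* (0≤q-p p≤q) (ℚ.≤-trans 0≤r r≤s)) (0≤* 0≤p (0≤q-p r≤s)))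
  (solve 4 (λ p q r s → p :* r :+ ((q :- p) :* s :+ p :* (s :- r)) := q :* s) refl p q r s)

p≤∣p∣ : ∀ p → p ≤ ℚ.∣ p ∣
p≤∣p∣ p with ℚ.≤-total 0ℚ p
... | inj₁ 0≤p = ℚ.≤-reflexive (sym (ℚ.0≤p⇒∣p∣≡p 0≤p))
... | inj₂ p≤0 = ℚ.≤-trans p≤0 (ℚ.0≤∣p∣ p)

0<½ : 0ℚ < ½
0<½ = ℚ.positive⁻¹ ½

0<1 : 0ℚ < 1ℚ
0<1 = ℚ.positive⁻¹ 1ℚ

halves : ∀ ε → ½ * ε + ½ * ε ≡ ε
halves ε = trans (sym (ℚ.*-distribʳ-+ ε ½ ½)) (ℚ.*-identityˡ ε)

quotient : ∀ {K ε} → 0ℚ < K → 0ℚ < ε → ∃ λ η → 0ℚ < η × K * η ≡ ε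
quotient {K} {ε} 0<K 0<ε = K⁻¹ * ε , 0<* 0<K⁻¹ 0<ε ,
  trans (sym (ℚ.*-assoc K K⁻¹ ε))
    (trans (cong (_* ε) (ℚ.*-inverseʳ K)) (ℚ.*-identityˡ ε))
  where
  instance
    K-pos     = ℚ.positive 0<K
    K-nonZero = ℚ.pos⇒nonZero K
  K⁻¹ = ℚ.1/ K
  0<K⁻¹ : 0ℚ < K⁻¹
  0<K⁻¹ = ℚ.positive⁻¹ K⁻¹ {{ℚ.1/pos⇒pos K}}

Eventually : (ℕ → Set) → Set
Eventually P = ∃ λ N → ∀ n → N ℕ.≤ n → P n

IsCauchy : (ℕ → ℚ) → Set
IsCauchy s = ∀ {ε} → 0ℚ < ε →
  ∃ λ N → ∀ m n → N ℕ.≤ m → N ℕ.≤ n → ℚ.∣ s m - s n ∣ < ε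

-- Cantor's construction: Cauchy sequences, compared by _≈ᴿ_.
record ℝ : Set where
  constructor mkℝ
  field
    seq    : ℕ → ℚ
    cauchy : IsCauchy seq

open ℝ public

infix 4 _≤ᴿ_ _<ᴿ_ _≈ᴿ_

_≤ᴿ_ _<ᴿ_ _≈ᴿ_ : ℝ → ℝ → Set
x ≤ᴿ y = ∀ {ε} → 0ℚ < ε → Eventually λ n → seq x n ≤ seq y n + ε
x <ᴿ y = ∃ λ δ → 0ℚ < δ × Eventually λ n → seq x n + δ ≤ seq y n
x ≈ᴿ y = x ≤ᴿ y × y ≤ᴿ x

fromℚ : ℚ → ℝ
fromℚ q = mkℝ (λ _ → q) λ {ε} 0<ε → 0 , λ _ _ _ _ →
  subst (_< ε) (sym (cong ℚ.∣_∣ (ℚ.+-inverseʳ q))) 0<ε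

eventually-× : ∀ {P Q : ℕ → Set} → Eventually P → Eventually Q →
               Eventually λ n → P n × Q n
eventually-× (M , p) (N , q) = M ℕ.⊔ N , λ n M⊔N≤n →
  p n (ℕ.m⊔n≤o⇒m≤o M N M⊔N≤n) , q n (ℕ.m⊔n≤o⇒n≤o M N M⊔N≤n)

eventually-∀ : ∀ {d} {P : Fin d → ℕ → Set} → (∀ i → Eventually (P i)) →
               Eventually λ n → ∀ i → P i n
eventually-∀ {zero}  _ = 0 , λ _ _ ()
eventually-∀ {suc d} p with eventually-× (p zero) (eventually-∀ (p ∘ suc))
... | N , q = N , λ n N≤n → λ where
  zero    → proj₁ (q n N≤n)
  (suc i) → proj₂ (q n N≤n) i

bounded : ∀ s → IsCauchy s → ∃ λ K → 0ℚ < K × Eventually λ n → ℚ.∣ s n ∣ ≤ K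
bounded s c with c 0<1
... | N , close = ℚ.∣ s N ∣ + 1ℚ , ℚ.+-mono-≤-< (ℚ.0≤∣p∣ (s N)) 0<1 , N , λ n N≤n →
  begin
    ℚ.∣ s n ∣                      ≡⟨ cong ℚ.∣_∣ (solve 2 (λ a b → a := b :+ (a :- b)) refl (s n) (s N)) ⟩
    ℚ.∣ s N + (s n - s N) ∣        ≤⟨ ℚ.∣p+q∣≤∣p∣+∣q∣ (s N) (s n - s N) ⟩
    ℚ.∣ s N ∣ + ℚ.∣ s n - s N ∣    ≤⟨ ℚ.+-monoʳ-≤ ℚ.∣ s N ∣ (ℚ.<⇒≤ (close n N N≤n ℕ.≤-refl)) ⟩
    ℚ.∣ s N ∣ + 1ℚ                 ∎
  where open ℚ.≤-Reasoning

abstract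
  +-cauchy : ∀ s t → IsCauchy s → IsCauchy t → IsCauchy (λ n → s n + t n)
  +-cauchy s t c d {ε} 0<ε with c (0<* 0<½ 0<ε) | d (0<* 0<½ 0<ε)
  ... | M , p | N , q = M ℕ.⊔ N , λ m n M⊔N≤m M⊔N≤n → begin-strict
    ℚ.∣ (s m + t m) - (s n + t n) ∣          ≡⟨ cong ℚ.∣_∣ (solve 4 (λ a b a′ b′ →
                                                  (a :+ b) :- (a′ :+ b′) := (a :- a′) :+ (b :- b′))
                                                  refl (s m) (t m) (s n) (t n)) ⟩
    ℚ.∣ (s m - s n) + (t m - t n) ∣          ≤⟨ ℚ.∣p+q∣≤∣p∣+∣q∣ (s m - s n) (t m - t n) ⟩
    ℚ.∣ s m - s n ∣ + ℚ.∣ t m - t n ∣        <⟨ ℚ.+-mono-<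
                                                  (p m n (ℕ.m⊔n≤o⇒m≤o M N M⊔N≤m) (ℕ.m⊔n≤o⇒m≤o M N M⊔N≤n))
                                                  (q m n (ℕ.m⊔n≤o⇒n≤o M N M⊔N≤m) (ℕ.m⊔n≤o⇒n≤o M N M⊔N≤n)) ⟩
    ½ * ε + ½ * ε                            ≡⟨ halves ε ⟩
    ε                                        ∎
    where open ℚ.≤-Reasoning

abstract
  neg-cauchy : ∀ s → IsCauchy s → IsCauchy (λ n → - s n)
  neg-cauchy s c {ε} 0<ε with c 0<ε
  ... | N , p = N , λ m n N≤m N≤n → subst (_< ε)
    (trans (sym (ℚ.∣-p∣≡∣p∣ (s m - s n)))
           (cong ℚ.∣_∣ (solve 2 (λ a b → :- (a :- b) := :- a :- :- b) refl (s m) (s n))))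
    (p m n N≤m N≤n)

*-close : ∀ {K L η} a b a′ b′ → 0ℚ < K → 0ℚ < L → ℚ.∣ a ∣ ≤ K → ℚ.∣ b′ ∣ ≤ L →
          ℚ.∣ a - a′ ∣ < η → ℚ.∣ b - b′ ∣ < η → ℚ.∣ a * b - a′ * b′ ∣ < (K + L) * η
*-close {K} {L} {η} a b a′ b′ 0<K 0<L a≤K b′≤L a~a′ b~b′ = begin-strict
  ℚ.∣ a * b - a′ * b′ ∣                           ≡⟨ cong ℚ.∣_∣ (split a b a′ b′) ⟩
  ℚ.∣ a * (b - b′) + (a - a′) * b′ ∣              ≤⟨ ℚ.∣p+q∣≤∣p∣+∣q∣ (a * (b - b′)) ((a - a′) * b′) ⟩
  ℚ.∣ a * (b - b′) ∣ + ℚ.∣ (a - a′) * b′ ∣        ≡⟨ cong₂ _+_ (ℚ.∣p*q∣≡∣p∣*∣q∣ a (b - b′))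
                                                               (ℚ.∣p*q∣≡∣p∣*∣q∣ (a - a′) b′) ⟩
  ℚ.∣ a ∣ * ℚ.∣ b - b′ ∣ + ℚ.∣ a - a′ ∣ * ℚ.∣ b′ ∣
                                                  ≤⟨ ℚ.+-mono-≤
                                                       (*-mono (ℚ.0≤∣p∣ a) a≤K (ℚ.0≤∣p∣ (b - b′)) ℚ.≤-refl)
                                                       (*-mono (ℚ.0≤∣p∣ (a - a′)) ℚ.≤-refl (ℚ.0≤∣p∣ b′) b′≤L) ⟩
  K * ℚ.∣ b - b′ ∣ + ℚ.∣ a - a′ ∣ * L             <⟨ ℚ.+-mono-<
                                                       (ℚ.*-monoʳ-<-pos K {{ℚ.positive 0<K}} b~b′)
                                                       (ℚ.*-monoˡ-<-pos L {{ℚ.positive 0<L}} a~a′) ⟩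
  K * η + η * L                                   ≡⟨ cong (λ z → K * η + z) (ℚ.*-comm η L) ⟩
  K * η + L * η                                   ≡⟨ ℚ.*-distribʳ-+ η K L ⟨
  (K + L) * η                                     ∎
  where
  open ℚ.≤-Reasoning
  split : ∀ a b a′ b′ → a * b - a′ * b′ ≡ a * (b - b′) + (a - a′) * b′
  split = solve 4 (λ a b a′ b′ →
    a :* b :- a′ :* b′ := a :* (b :- b′) :+ (a :- a′) :* b′) refl

abstract
  *-cauchy : ∀ s t → IsCauchy s → IsCauchy t → IsCauchy (λ n → s n * t n)
  *-cauchy s t c d {ε} 0<ε =
    let K , 0<K , B₁ , s≤K = bounded s c
        L , 0<L , B₂ , t≤L = bounded t d
        η , 0<η , Kη≡ε     = quotient (ℚ.+-mono-< 0<K 0<L) 0<ε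
        M , s~             = c 0<η
        N , t~             = d 0<η
        B , bounds         = eventually-× (B₁ , s≤K) (B₂ , t≤L)
    in B ℕ.⊔ (M ℕ.⊔ N) , λ m n le le′ →
      let m≥ = ℕ.m⊔n≤o⇒n≤o B (M ℕ.⊔ N) le
          n≥ = ℕ.m⊔n≤o⇒n≤o B (M ℕ.⊔ N) le′
      in subst (ℚ.∣ s m * t m - s n * t n ∣ <_) Kη≡ε
        (*-close (s m) (t m) (s n) (t n) 0<K 0<L
          (proj₁ (bounds m (ℕ.m⊔n≤o⇒m≤o B (M ℕ.⊔ N) le)))
          (proj₂ (bounds n (ℕ.m⊔n≤o⇒m≤o B (M ℕ.⊔ N) le′)))
          (s~ m n (ℕ.m⊔n≤o⇒m≤o M N m≥) (ℕ.m⊔n≤o⇒m≤o M N n≥))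
          (t~ m n (ℕ.m⊔n≤o⇒n≤o M N m≥) (ℕ.m⊔n≤o⇒n≤o M N n≥)))

infixl 6 _+ᴿ_
infixl 7 _*ᴿ_
infix  8 -ᴿ_

0ᴿ 1ᴿ : ℝ
0ᴿ = fromℚ 0ℚ
1ᴿ = fromℚ 1ℚ

_+ᴿ_ _*ᴿ_ : ℝ → ℝ → ℝ
x +ᴿ y = mkℝ (λ n → seq x n + seq y n) (+-cauchy (seq x) (seq y) (cauchy x) (cauchy y))
x *ᴿ y = mkℝ (λ n → seq x n * seq y n) (*-cauchy (seq x) (seq y) (cauchy x) (cauchy y))

-ᴿ_ : ℝ → ℝ
-ᴿ x = mkℝ (λ n → - seq x n) (neg-cauchy (seq x) (cauchy x))

ℝ-rawRing : RawRing 0ℓ 0ℓ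
ℝ-rawRing = record
  { _≈_ = _≈ᴿ_ ; _+_ = _+ᴿ_ ; _*_ = _*ᴿ_ ; -_ = -ᴿ_ ; 0# = 0ᴿ ; 1# = 1ᴿ }

open RawSemiringOps (RawRing.rawSemiring ℝ-rawRing) public
  using () renaming (sum to ∑ᴿ; product to ∏ᴿ; _^_ to _^ᴿ_)

-- The value at 0 is irrelevant: only finitely many terms of a sequence
-- representing a positive real are 0.
recip : ℚ → ℚ
recip q with q ℚ.≟ 0ℚ
... | yes _   = 0ℚ
... | no  q≢0 = ℚ.1/_ q {{ℚ.≢-nonZero q≢0}}

recip-inverse : ∀ {q} → 0ℚ < q → recip q * q ≡ 1ℚ
recip-inverse {q} 0<q with q ℚ.≟ 0ℚ
... | yes q≡0 = contradiction (sym q≡0) (ℚ.<⇒≢ 0<q)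
... | no  q≢0 = ℚ.*-inverseˡ q {{ℚ.≢-nonZero q≢0}}

recip-pos : ∀ {q} → 0ℚ < q → 0ℚ < recip q
recip-pos {q} 0<q with q ℚ.≟ 0ℚ
... | yes q≡0 = contradiction (sym q≡0) (ℚ.<⇒≢ 0<q)
... | no  q≢0 = ℚ.positive⁻¹ _ {{ℚ.1/pos⇒pos q {{ℚ.positive 0<q}}}}

recip-close : ∀ {δ ε a b} → 0ℚ < δ → 0ℚ < ε → δ ≤ a → δ ≤ b →
              ℚ.∣ a - b ∣ < δ * δ * ε → ℚ.∣ recip a - recip b ∣ < ε
recip-close {δ} {ε} {a} {b} 0<δ 0<ε δ≤a δ≤b a~b = begin-strict
  ℚ.∣ a⁻¹ - b⁻¹ ∣                     ≡⟨ cong ℚ.∣_∣ (sym (trans (cong₂ _-_ (ℚ.*-identityʳ a⁻¹) (ℚ.*-identityˡ b⁻¹)) refl)) ⟩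
  ℚ.∣ a⁻¹ * 1ℚ - 1ℚ * b⁻¹ ∣           ≡⟨ cong₂ (λ u v → ℚ.∣ a⁻¹ * u - v * b⁻¹ ∣)
                                           (sym (recip-inverse 0<b)) (sym (recip-inverse 0<a)) ⟩
  ℚ.∣ a⁻¹ * (b⁻¹ * b) - (a⁻¹ * a) * b⁻¹ ∣
                                      ≡⟨ cong ℚ.∣_∣ (solve 4 (λ a b a⁻¹ b⁻¹ →
                                           a⁻¹ :* (b⁻¹ :* b) :- (a⁻¹ :* a) :* b⁻¹ := (:- (a :- b)) :* (a⁻¹ :* b⁻¹))
                                           refl a b a⁻¹ b⁻¹) ⟩
  ℚ.∣ (- (a - b)) * (a⁻¹ * b⁻¹) ∣     ≡⟨ ℚ.∣p*q∣≡∣p∣*∣q∣ (- (a - b)) (a⁻¹ * b⁻¹) ⟩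
  ℚ.∣ - (a - b) ∣ * ℚ.∣ a⁻¹ * b⁻¹ ∣   ≡⟨ cong₂ _*_ (ℚ.∣-p∣≡∣p∣ (a - b)) (ℚ.0≤p⇒∣p∣≡p (ℚ.<⇒≤ 0<ab)) ⟩
  ℚ.∣ a - b ∣ * (a⁻¹ * b⁻¹)           <⟨ ℚ.*-monoˡ-<-pos (a⁻¹ * b⁻¹) {{ℚ.positive 0<ab}} a~b ⟩
  δ * δ * ε * (a⁻¹ * b⁻¹)             ≡⟨ solve 4 (λ δ ε a⁻¹ b⁻¹ →
                                           δ :* δ :* ε :* (a⁻¹ :* b⁻¹) := (a⁻¹ :* δ) :* (b⁻¹ :* δ) :* ε)
                                           refl δ ε a⁻¹ b⁻¹ ⟩
  (a⁻¹ * δ) * (b⁻¹ * δ) * ε           ≤⟨ *-mono (0≤* (0≤* 0≤a⁻¹ 0≤δ) (0≤* 0≤b⁻¹ 0≤δ))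
                                           (*-mono (0≤* 0≤a⁻¹ 0≤δ) (*-mono 0≤a⁻¹ ℚ.≤-refl 0≤δ δ≤a)
                                                   (0≤* 0≤b⁻¹ 0≤δ) (*-mono 0≤b⁻¹ ℚ.≤-refl 0≤δ δ≤b))
                                           (ℚ.<⇒≤ 0<ε) ℚ.≤-refl ⟩
  (a⁻¹ * a) * (b⁻¹ * b) * ε           ≡⟨ cong₂ (λ u v → u * v * ε) (recip-inverse 0<a) (recip-inverse 0<b) ⟩
  1ℚ * 1ℚ * ε                         ≡⟨ ℚ.*-identityˡ ε ⟩
  ε                                   ∎
  where
  open ℚ.≤-Reasoning
  a⁻¹ = recip a
  b⁻¹ = recip b
  0<a = ℚ.<-≤-trans 0<δ δ≤a
  0<b = ℚ.<-≤-trans 0<δ δ≤b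
  0<ab : 0ℚ < a⁻¹ * b⁻¹
  0<ab = 0<* (recip-pos 0<a) (recip-pos 0<b)
  0≤a⁻¹ = ℚ.<⇒≤ (recip-pos 0<a)
  0≤b⁻¹ = ℚ.<⇒≤ (recip-pos 0<b)
  0≤δ = ℚ.<⇒≤ 0<δ

abstract
  recip-cauchy : ∀ x → 0ᴿ <ᴿ x → IsCauchy (recip ∘ seq x)
  recip-cauchy x (δ , 0<δ , M , δ≤x) {ε} 0<ε
    with N , p ← cauchy x (0<* (0<* 0<δ 0<δ) 0<ε)
    = M ℕ.⊔ N , λ m n le le′ → recip-close 0<δ 0<ε
        (subst (_≤ seq x m) (ℚ.+-identityˡ δ) (δ≤x m (ℕ.m⊔n≤o⇒m≤o M N le)))
        (subst (_≤ seq x n) (ℚ.+-identityˡ δ) (δ≤x n (ℕ.m⊔n≤o⇒m≤o M N le′)))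
        (p m n (ℕ.m⊔n≤o⇒n≤o M N le) (ℕ.m⊔n≤o⇒n≤o M N le′))

1/ᴿ : (x : ℝ) → 0ᴿ <ᴿ x → ℝ
1/ᴿ x 0<x = mkℝ (recip ∘ seq x) (recip-cauchy x 0<x)

record Simplex (d : ℕ) : Set where
  field
    coord  : Fin d → ℝ
    0≤     : ∀ i → 0ᴿ ≤ᴿ coord i
    <1     : ∀ i → coord i <ᴿ 1ᴿ
    sum≈1  : ∑ᴿ coord ≈ᴿ 1ᴿ

open RawSemiringOps ℚ.+-*-rawSemiring using (_^_) renaming (sum to ∑)

seq-^ : ∀ x k n → seq (x ^ᴿ k) n ≡ seq x n ^ k
seq-^ x zero    n = refl
seq-^ x (suc k) n = cong (seq x n *_) (seq-^ x k n)

seq-∑ : ∀ {d} (x : Fin d → ℝ) n → seq (∑ᴿ x) n ≡ ∑ (λ i → seq (x i) n)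
seq-∑ {zero}  x n = refl
seq-∑ {suc d} x n = cong (seq (x zero) n +_) (seq-∑ (x ∘ suc) n)

lowerBound : ∀ {d} (f : Fin d → ℚ) → (∀ i → 0ℚ < f i) →
             ∃ λ δ → 0ℚ < δ × δ ≤ ½ × (∀ i → δ ≤ f i)
lowerBound {zero}  f 0<f = ½ , 0<½ , ℚ.≤-refl , λ ()
lowerBound {suc d} f 0<f with lowerBound (f ∘ suc) (0<f ∘ suc)
... | δ , 0<δ , δ≤½ , δ≤f with ℚ.≤-total δ (f zero)
...   | inj₁ δ≤f₀ = δ , 0<δ , δ≤½ , λ { zero → δ≤f₀ ; (suc i) → δ≤f i }
...   | inj₂ f₀≤δ = f zero , 0<f zero , ℚ.≤-trans f₀≤δ δ≤½ ,
                    λ { zero → ℚ.≤-refl ; (suc i) → ℚ.≤-trans f₀≤δ (δ≤f i) }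

∑-const : ∀ d η → ∑ {d} (λ _ → η + η) ≡ ∑ {d} (λ _ → 1ℚ + 1ℚ) * η
∑-const zero    η = sym (ℚ.*-zeroˡ η)
∑-const (suc d) η = trans
  (cong₂ _+_ (trans (cong₂ _+_ (sym (ℚ.*-identityˡ η)) (sym (ℚ.*-identityˡ η)))
                    (sym (ℚ.*-distribʳ-+ η 1ℚ 1ℚ)))
             (∑-const d η))
  (sym (ℚ.*-distribʳ-+ η (1ℚ + 1ℚ) (∑ {d} (λ _ → 1ℚ + 1ℚ))))

∑-nonNeg : ∀ d {η} → 0ℚ ≤ η → 0ℚ ≤ ∑ {d} (λ _ → η)
∑-nonNeg zero    0≤η = ℚ.≤-refl
∑-nonNeg (suc d) 0≤η = 0≤+ 0≤η (∑-nonNeg d 0≤η)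

smallStep : ∀ d {δ} → 0ℚ < δ → ∃ λ η → 0ℚ < η × η + ∑ {d} (λ _ → η + η) ≡ δ
smallStep d {δ} 0<δ =
  let η , 0<η , eq = quotient (ℚ.+-mono-<-≤ 0<1 (∑-nonNeg d {1ℚ + 1ℚ} (0≤+ 0≤1 0≤1))) 0<δ
  in η , 0<η , trans (cong₂ _+_ (sym (ℚ.*-identityˡ η)) (∑-const d η))
                     (trans (sym (ℚ.*-distribʳ-+ η 1ℚ (∑ {d} (λ _ → 1ℚ + 1ℚ)))) eq)
  where 0≤1 = ℚ.<⇒≤ 0<1

∣x∣≤x+2η : ∀ x {η} → 0ℚ ≤ η → 0ℚ ≤ x + η → ℚ.∣ x ∣ ≤ x + (η + η)
∣x∣≤x+2η x {η} 0≤η 0≤x+η with ℚ.∣p∣≡p∨∣p∣≡-p x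
... | inj₁ eq = subst (_≤ x + (η + η)) (sym eq) (≤-by (η + η) (0≤+ 0≤η 0≤η) refl)
... | inj₂ eq = subst (_≤ x + (η + η)) (sym eq)
  (≤-by ((x + η) + (x + η)) (0≤+ 0≤x+η 0≤x+η)
    (solve 2 (λ x η → :- x :+ ((x :+ η) :+ (x :+ η)) := x :+ (η :+ η)) refl x η))

∣x∣≤c : ∀ x {η c} → 0ℚ ≤ x + η → η ≤ c → x ≤ c → ℚ.∣ x ∣ ≤ c
∣x∣≤c x {η} {c} 0≤x+η η≤c x≤c with ℚ.∣p∣≡p∨∣p∣≡-p x
... | inj₁ eq = subst (_≤ c) (sym eq) x≤c
... | inj₂ eq = subst (_≤ c) (sym eq)
  (ℚ.≤-trans (≤-by (x + η) 0≤x+η (solve 2 (λ x η → :- x :+ (x :+ η) := η) refl x η)) η≤c)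

∣x^k∣≤1 : ∀ x k → ℚ.∣ x ∣ ≤ 1ℚ → ℚ.∣ x ^ k ∣ ≤ 1ℚ
∣x^k∣≤1 x zero    ∣x∣≤1 = ℚ.≤-refl
∣x^k∣≤1 x (suc k) ∣x∣≤1 = subst (_≤ 1ℚ) (sym (ℚ.∣p*q∣≡∣p∣*∣q∣ x (x ^ k)))
  (*-mono (ℚ.0≤∣p∣ x) ∣x∣≤1 (ℚ.0≤∣p∣ (x ^ k)) (∣x^k∣≤1 x k ∣x∣≤1))

x^k≤cx : ∀ x {η c k} → 2 ℕ.≤ k → 0ℚ ≤ η → 0ℚ ≤ x + η → η ≤ c → c ≤ 1ℚ → x ≤ c →
         x ^ k ≤ c * (x + (η + η))
x^k≤cx x {η} {c} {suc (suc k)} (s≤s (s≤s z≤n)) 0≤η 0≤x+η η≤c c≤1 x≤c = begin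
  x * (x * x ^ k)                     ≤⟨ p≤∣p∣ (x * (x * x ^ k)) ⟩
  ℚ.∣ x * (x * x ^ k) ∣               ≡⟨ ℚ.∣p*q∣≡∣p∣*∣q∣ x (x * x ^ k) ⟩
  ℚ.∣ x ∣ * ℚ.∣ x * x ^ k ∣           ≡⟨ cong (ℚ.∣ x ∣ *_) (ℚ.∣p*q∣≡∣p∣*∣q∣ x (x ^ k)) ⟩
  ℚ.∣ x ∣ * (ℚ.∣ x ∣ * ℚ.∣ x ^ k ∣)   ≤⟨ *-mono 0≤∣x∣ ∣x∣≤ (0≤* 0≤∣x∣ 0≤∣x^k∣)
                                           (*-mono 0≤∣x∣ (∣x∣≤x+2η x 0≤η 0≤x+η) 0≤∣x^k∣
                                                   (∣x^k∣≤1 x k (ℚ.≤-trans ∣x∣≤ c≤1))) ⟩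
  c * ((x + (η + η)) * 1ℚ)            ≡⟨ cong (c *_) (ℚ.*-identityʳ (x + (η + η))) ⟩
  c * (x + (η + η))                   ∎
  where
  open ℚ.≤-Reasoning
  0≤∣x∣ = ℚ.0≤∣p∣ x
  0≤∣x^k∣ = ℚ.0≤∣p∣ (x ^ k)
  ∣x∣≤ = ∣x∣≤c x 0≤x+η η≤c x≤c

regroup : ∀ a b c η w → c * (a + η) + c * (b + w) ≡ c * ((a + b) + (η + w))
regroup = solve 5 (λ a b c η w → c :* (a :+ η) :+ c :* (b :+ w) := c :* ((a :+ b) :+ (η :+ w))) refl

∑-bound : ∀ {d} (f g : Fin d → ℚ) c η → (∀ i → f i ≤ c * (g i + η)) →
          ∑ f ≤ c * (∑ g + ∑ {d} (λ _ → η))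
∑-bound {zero}  f g c η f≤ = ℚ.≤-reflexive (sym (ℚ.*-zeroʳ c))
∑-bound {suc d} f g c η f≤ = begin
  f zero + ∑ (f ∘ suc)                            ≤⟨ ℚ.+-mono-≤ {x = f zero} (f≤ zero)
                                                       (∑-bound (f ∘ suc) (g ∘ suc) c η (f≤ ∘ suc)) ⟩
  c * (g zero + η) + c * (∑ (g ∘ suc) + W)        ≡⟨ regroup (g zero) (∑ (g ∘ suc)) c η W ⟩
  c * ((g zero + ∑ (g ∘ suc)) + (η + W))          ∎
  where
  open ℚ.≤-Reasoning
  W = ∑ {d} (λ _ → η)

∑^k≤ : ∀ {d} (x : Fin d → ℚ) {δ η k} → 2 ℕ.≤ k → 0ℚ < δ → δ ≤ ½ → 0ℚ < η →
       η + ∑ {d} (λ _ → η + η) ≡ δ → (∀ i → 0ℚ ≤ x i + η) → (∀ i → x i + δ ≤ 1ℚ) →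
       ∑ x ≤ 1ℚ + η → δ * δ ≤ 1ℚ - ∑ (λ i → x i ^ k)
∑^k≤ {d} x {δ} {η} {k} 2≤k 0<δ δ≤½ 0<η eq 0≤x x≤1 ∑x≤ = ≤-by (c * (1ℚ + δ) - S) (0≤q-p S≤)
  (squares 1ℚ refl)
  where
  open ℚ.≤-Reasoning
  c = 1ℚ - δ
  S = ∑ (λ i → x i ^ k)
  W = ∑ {d} (λ _ → η + η)
  squares : ∀ u → u * u ≡ u → δ * δ + ((u - δ) * (u + δ) - S) ≡ u - S
  squares u u²≡u = trans
    (solve 3 (λ u δ S → δ :* δ :+ ((u :- δ) :* (u :+ δ) :- S) := u :* u :- S) refl u δ S)
    (cong (λ v → v - S) u²≡u)
  0≤η = ℚ.<⇒≤ 0<η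
  η≤δ : η ≤ δ
  η≤δ = ≤-by W (∑-nonNeg d (0≤+ 0≤η 0≤η)) eq
  ½≤c : ½ ≤ c
  ½≤c = ℚ.+-monoʳ-≤ 1ℚ (ℚ.neg-antimono-≤ δ≤½)
  0≤c : 0ℚ ≤ c
  0≤c = ℚ.≤-trans (ℚ.<⇒≤ 0<½) ½≤c
  c≤1 : c ≤ 1ℚ
  c≤1 = ≤-by δ (ℚ.<⇒≤ 0<δ) (solve 2 (λ u δ → (u :- δ) :+ δ := u) refl 1ℚ δ)
  x≤c : ∀ i → x i ≤ c
  x≤c i = subst (_≤ c) (solve 2 (λ x δ → (x :+ δ) :- δ := x) refl (x i) δ)
    (ℚ.+-monoˡ-≤ (- δ) (x≤1 i))
  S≤ : S ≤ c * (1ℚ + δ)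
  S≤ = begin
    S                      ≤⟨ ∑-bound (λ i → x i ^ k) x c (η + η) (λ i →
                                x^k≤cx (x i) 2≤k 0≤η (0≤x i) (ℚ.≤-trans η≤δ (ℚ.≤-trans δ≤½ ½≤c)) c≤1 (x≤c i)) ⟩
    c * (∑ x + W)          ≤⟨ ℚ.*-monoˡ-≤-nonNeg c {{ℚ.nonNegative 0≤c}} (ℚ.+-monoˡ-≤ W ∑x≤) ⟩
    c * ((1ℚ + η) + W)     ≡⟨ cong (c *_) (trans (ℚ.+-assoc 1ℚ η W) (cong (1ℚ +_) eq)) ⟩
    c * (1ℚ + δ)           ∎

denominator : ∀ {d} → ℕ → Simplex d → ℝ
denominator k x = 1ᴿ +ᴿ -ᴿ ∑ᴿ (λ i → Simplex.coord x i ^ᴿ k)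

abstract
  denominator-pos : ∀ {d k} → 2 ℕ.≤ k → (x : Simplex d) → 0ᴿ <ᴿ denominator k x
  denominator-pos {d} {k} 2≤k x =
    let δ , 0<δ , δ≤½ , δ≤gap = lowerBound (λ i → proj₁ (<1 i)) (λ i → proj₁ (proj₂ (<1 i)))
        η , 0<η , eq = smallStep d 0<δ
        N , bounds = eventually-×
          (eventually-× (eventually-∀ λ i → 0≤ i 0<η) (eventually-∀ λ i → proj₂ (proj₂ (<1 i))))
          (proj₁ sum≈1 0<η)
    in δ * δ , 0<* 0<δ 0<δ , N , λ n N≤n →
       let (0≤x , x<1) , ∑x≤1 = bounds n N≤n
       in subst₂ _≤_ (sym (ℚ.+-identityˡ (δ * δ))) (cong (λ S → 1ℚ - S) (sym (seq-∑^ n)))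
            (∑^k≤ (λ i → seq (coord i) n) 2≤k 0<δ δ≤½ 0<η eq 0≤x
              (λ i → ℚ.≤-trans (ℚ.+-monoʳ-≤ (seq (coord i) n) (δ≤gap i)) (x<1 i))
              (subst (_≤ 1ℚ + η) (seq-∑ coord n) ∑x≤1))
    where
    open Simplex x
    seq-∑^ : ∀ n → seq (∑ᴿ (λ i → coord i ^ᴿ k)) n ≡ ∑ (λ i → seq (coord i) n ^ k)
    seq-∑^ n = trans (seq-∑ (λ i → coord i ^ᴿ k) n) (∑-cong (λ i → seq-^ (coord i) k n))
      where
      ∑-cong : ∀ {d} {f g : Fin d → ℚ} → (∀ i → f i ≡ g i) → ∑ f ≡ ∑ g
      ∑-cong {zero}  eq = refl
      ∑-cong {suc d} eq = cong₂ _+_ (eq zero) (∑-cong (eq ∘ suc))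

Z : ∀ {d} (D : Tree d) → 2 ℕ.≤ ‖ D ‖ → Representatives D → Simplex d → ℝ
Z D 2≤‖D‖ M x =
  1/ᴿ (denominator ‖ D ‖ x) (denominator-pos 2≤‖D‖ x) *ᴿ
  List.foldr _+ᴿ_ 0ᴿ
    (List.map (λ π → ∏ᴿ λ j → coord j ^ᴿ ‖ branches D (π ⟨$⟩ʳ j) ‖) (Representatives.list M))
  where open Simplex x

-- A value v is represented by the set of all rationals q with v < q, so that
-- arbitrary suprema and infima exist (the empty set represents ∞); larger values have smaller cuts.
record [0,∞] : Set₁ where
  field
    cut      : ℚ → Set
    positive : ∀ {q} → cut q → 0ℚ < q
    upward   : ∀ {q r} → q < r → cut q → cut r
    rounded  : ∀ {q} → cut q → ∃ λ r → r < q × cut r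

open [0,∞] using (cut)

infix 4 _≤∞_ _≈∞_

_≤∞_ _≈∞_ : [0,∞] → [0,∞] → Set
v ≤∞ w = ∀ {q} → cut w q → cut v q
v ≈∞ w = v ≤∞ w × w ≤∞ v

⊔-< : ∀ {p q r} → p < r → q < r → p ℚ.⊔ q < r
⊔-< {p} {q} {r} p<r q<r with ℚ.⊔-sel p q
... | inj₁ eq = subst (_< r) (sym eq) p<r
... | inj₂ eq = subst (_< r) (sym eq) q<r

slack : ∀ a {q δ} r → a + δ ≤ q → a + (r - (q - δ)) ≤ r
slack a {q} {δ} r a+δ≤q = ≤-by (q - (a + δ)) (0≤q-p a+δ≤q) (regroup′ a q δ r)
  where
  regroup′ : ∀ a q δ r → (a + (r - (q - δ))) + (q - (a + δ)) ≡ r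
  regroup′ = solve 4 (λ a q δ r → (a :+ (r :- (q :- δ))) :+ (q :- (a :+ δ)) := r) refl

<fromℚ-rounded : ∀ x {q} → 0ℚ < q → x <ᴿ fromℚ q →
                 ∃ λ r → r < q × 0ℚ < r × x <ᴿ fromℚ r
<fromℚ-rounded x {q} 0<q (δ , 0<δ , N , x≤q) =
  let r , m<r , r<q = ℚ.<-dense (⊔-< 0<q q-δ<q)
  in r , r<q , ℚ.≤-<-trans (ℚ.p≤p⊔q 0ℚ (q - δ)) m<r ,
     r - (q - δ) , 0<q-p (ℚ.≤-<-trans (ℚ.p≤q⊔p 0ℚ (q - δ)) m<r) , N ,
     λ n N≤n → slack (seq x n) r (x≤q n N≤n)
  where
  q-δ<q : q - δ < q
  q-δ<q = <-by δ 0<δ (solve 2 (λ q δ → (q :- δ) :+ δ := q) refl q δ)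

-- Negative reals are sent to 0; only nonnegative ones occur below.
upper : ℝ → [0,∞]
upper x = record
  { cut      = λ q → 0ℚ < q × x <ᴿ fromℚ q
  ; positive = proj₁
  ; upward   = λ { q<r (0<q , δ , 0<δ , N , x≤q) → ℚ.<-trans 0<q q<r , δ , 0<δ , N ,
                   λ n N≤n → ℚ.≤-trans (x≤q n N≤n) (ℚ.<⇒≤ q<r) }
  ; rounded  = λ { (0<q , x<q) → <fromℚ-rounded x 0<q x<q }
  }

upperℚ : ℚ → [0,∞]
upperℚ q = upper (fromℚ q)

infixl 7 _*∞_

_*∞_ : [0,∞] → [0,∞] → [0,∞]
v *∞ w = record
  { cut      = λ q → ∃ λ a → ∃ λ b → cut v a × cut w b × a * b < q
  ; positive = λ { (a , b , v<a , w<b , ab<q) →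
                   ℚ.<-trans (0<* ([0,∞].positive v v<a) ([0,∞].positive w w<b)) ab<q }
  ; upward   = λ { q<r (a , b , v<a , w<b , ab<q) → a , b , v<a , w<b , ℚ.<-trans ab<q q<r }
  ; rounded  = λ { (a , b , v<a , w<b , ab<q) →
                   let r , ab<r , r<q = ℚ.<-dense ab<q in r , r<q , a , b , v<a , w<b , ab<r }
  }

*∞-rawMonoid : RawMonoid _ 0ℓ
*∞-rawMonoid = record { _≈_ = _≈∞_ ; _∙_ = _*∞_ ; ε = upperℚ 1ℚ }

open RawMonoidOps *∞-rawMonoid public using () renaming (sum to ∏∞)

⨆ : {A : Set} → (A → [0,∞]) → [0,∞]
⨆ v = record
  { cut      = λ q → ∃ λ r → 0ℚ < r × r < q × (∀ a → cut (v a) r)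
  ; positive = λ { (r , 0<r , r<q , _) → ℚ.<-trans 0<r r<q }
  ; upward   = λ { q<q′ (r , 0<r , r<q , v<r) → r , 0<r , ℚ.<-trans r<q q<q′ , v<r }
  ; rounded  = λ { (r , 0<r , r<q , v<r) →
                   let q′ , r<q′ , q′<q = ℚ.<-dense r<q in q′ , q′<q , r , 0<r , r<q′ , v<r }
  }

⨅ : {A : Set} → (A → [0,∞]) → [0,∞]
⨅ v = record
  { cut      = λ q → ∃ λ a → cut (v a) q
  ; positive = λ { (a , v<q) → [0,∞].positive (v a) v<q }
  ; upward   = λ { q<r (a , v<q) → a , [0,∞].upward (v a) q<r v<q }
  ; rounded  = λ { (a , v<q) → let r , r<q , v<r = [0,∞].rounded (v a) v<q in r , r<q , a , v<r }
  }

limsup : (ℕ → [0,∞]) → [0,∞]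
limsup v = ⨅ λ N → ⨆ {∃ λ n → N ℕ.≤ n} λ (n , _) → v n

-- Up to isomorphism there are finitely many trees with n leaves, so the
-- supremum over all of them is the maximum.
maxDensity : ∀ {d} → Tree d → ℕ → [0,∞]
maxDensity {d} D n = ⨆ {∃ λ (T : Tree d) → ‖ T ‖ ≡ n} λ (T , _) → upperℚ (density D T)

inducibility : ∀ {d} → Tree d → [0,∞]
inducibility empty      = upperℚ 1ℚ
inducibility D@(just _) = limsup (maxDensity D)

{-# OPTIONS --safe #-}

-- Let k = ‖D‖, and let T have branches T_1, …, T_d with n_1, …, n_d leaves.  A copy
-- of D in T either lies in a single T_j or consists of copies of the D_π(j) in the
-- T_j for some π in M(D), whence
--   c(D,T) ≤ Σ_j c(D,T_j) + Σ_π Π_j c(D_π(j),T_j).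
-- If c_i > I(D_i), then c(D_i,T) ≤ c_i ‖T‖^k_i / k_i! once ‖T‖ ≥ N (always, if
-- k_i ≤ 1).  A product in which some n_j < N while ‖D_π(j)‖ ≥ 2 is at most
-- N (n^(k-1) - Σ_j n_j^(k-1)), because it is N times a mixed monomial of degree k-1.
-- With r an upper bound of Z_D, the main terms add up to at most
-- r Π_i (c_i / k_i!) (n^k - Σ_j n_j^k).  Both bounds telescope, so by induction
--   c(D,T) ≤ r Π_i (c_i / k_i!) n^k + E n^(k-1),
-- which is divided by the binomial coefficient (n choose k) ~ n^k / k!.

module Submission where

open import Defs

-- Values in `[0,∞]` are upper cuts, so `v ≤∞ w` asks that every rational above w be above v. A
-- rational q above the right-hand side comes with rational witnesses: c_i above I(D_i) and r above
-- every value of Z_D. From there on all inequalities are between rationals, for trees of finite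
-- size, and the limit superior is formed only at the very end. The obstacle is that c_i > I(D_i)
-- says nothing about small hosts, while a large tree may have small branches at every level. The
-- error made at a node is therefore measured by n^(k-1) - Σ_j n_j^(k-1), so that the errors of the
-- whole tree sum to order n^(k-1), one below the main term. This needs the bad branch of D to have
-- at least two leaves: after one factor n_j is traded for N, a positive power of n_j must survive
-- for the monomial to remain mixed. Branches of D with at most one leaf are safe because there c_i
-- is at least 1 and the trivial bound suffices. Z_D is evaluated only at the rational points n_j /
-- n. Their coordinates are below 1 because a root has at least two children.

module Counting where

  open import Data.Empty using (⊥-elim)
  open import Data.Fin.Base using (Fin; zero; suc; inject₁; fromℕ; punchIn)
  open import Data.Fin.Permutation as Perm using (Permutation; Permutation′; _⟨$⟩ʳ_; _∘ₚ_)
  import Data.Fin.Properties as Fin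
  open import Data.Fin.Subset using (Subset; inside; outside; ∣_∣)
  open import Data.List.Base as List using (List; []; _∷_; length; lookup; filter)
  import Data.List.Properties as List
  open import Data.List.Relation.Unary.Any as Any using (Any; here; there)
  open import Data.Maybe.Base using (Maybe; just; nothing)
  open import Data.Maybe.Relation.Binary.Pointwise as Maybe using (just; nothing)
  open import Data.Nat.Base
  open import Data.Nat.Combinatorics using (_C_; nCk+nC[k+1]≡[n+1]C[k+1])
  open import Data.Nat.ListAction using (sum)
  open import Data.Nat.ListAction.Properties using (sum-++)
  open import Data.Nat.Properties
  open import Data.Nat.Tactic.RingSolver using (solve-∀)
  open import Data.Product.Base using (Σ; ∃; _,_; proj₁; proj₂)
  open import Data.Vec.Base using ([]; _∷_; take; drop)
  open import Function.Base using (_∘_)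
  open import Relation.Binary.PropositionalEquality
  open import Relation.Nullary using (Dec; yes; no)
  open import Relation.Unary using (Decidable)
  open import Algebra.Properties.Semiring.Sum +-*-semiring using ()
    renaming (sum to ∑; sum-cong-≗ to ∑-cong; sum-permute to ∑-permute) public
  open import Algebra.Properties.CommutativeMonoid.Sum *-1-commutativeMonoid public using ()
    renaming (sum to ∏; sum-permute to ∏-permute)

  private
    variable
      d k n : ℕ
      P Q A B : Set

  -- Indicators, and sums over indices and over leaf sets.

  indicator : Dec P → ℕ
  indicator (yes _) = 1
  indicator (no  _) = 0

  indicator-mono : (P? : Dec P) (Q? : Dec Q) → (P → Q) → indicator P? ≤ indicator Q?
  indicator-mono (yes p) (yes _) f = ≤-refl
  indicator-mono (yes p) (no ¬q) f = ⊥-elim (¬q (f p))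
  indicator-mono (no  _) _       f = z≤n

  indicator-cong : (P? : Dec P) (Q? : Dec Q) → (P → Q) → (Q → P) → indicator P? ≡ indicator Q?
  indicator-cong P? Q? f g = ≤-antisym (indicator-mono P? Q? f) (indicator-mono Q? P? g)

  1≤indicator : (P? : Dec P) → P → 1 ≤ indicator P?
  1≤indicator P? p = indicator-mono (yes p) P? (λ p → p)

  indicator≤ : (P? : Dec P) → (P → 1 ≤ n) → indicator P? ≤ n
  indicator≤ (yes p) f = f p
  indicator≤ (no  _) f = z≤n

  ∑-mono : {f g : Fin n → ℕ} → (∀ i → f i ≤ g i) → ∑ f ≤ ∑ g
  ∑-mono {n = zero}  f≤g = z≤n
  ∑-mono {n = suc n} f≤g = +-mono-≤ (f≤g zero) (∑-mono (f≤g ∘ suc))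

  ∏-mono : {f g : Fin n → ℕ} → (∀ i → f i ≤ g i) → ∏ f ≤ ∏ g
  ∏-mono {n = zero}  f≤g = ≤-refl
  ∏-mono {n = suc n} f≤g = *-mono-≤ (f≤g zero) (∏-mono (f≤g ∘ suc))

  1≤∏ : {f : Fin n → ℕ} → (∀ i → 1 ≤ f i) → 1 ≤ ∏ f
  1≤∏ {n = zero}  1≤f = ≤-refl
  1≤∏ {n = suc n} 1≤f = *-mono-≤ (1≤f zero) (1≤∏ (1≤f ∘ suc))

  term≤∑ : (f : Fin n → ℕ) (i : Fin n) → f i ≤ ∑ f
  term≤∑ f zero    = m≤m+n (f zero) _
  term≤∑ f (suc i) = ≤-trans (term≤∑ (f ∘ suc) i) (m≤n+m _ (f zero))

  term≤sum : {A : Set} (f : A → ℕ) {xs : List A} → Any (λ x → 1 ≤ f x) xs → 1 ≤ sum (List.map f xs)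
  term≤sum f (here 1≤fx)        = ≤-trans 1≤fx (m≤m+n _ _)
  term≤sum f {x ∷ xs} (there p) = ≤-trans (term≤sum f p) (m≤n+m _ (f x))

  -- Recursion on the first leaf, instead of a sum over the list `subsets`, lets a sum over the leaf
  -- sets of a forest factor by induction along `take` and `drop`.
  ∑ₛ : ∀ n → (Subset n → ℕ) → ℕ
  ∑ₛ zero    f = f []
  ∑ₛ (suc n) f = ∑ₛ n (f ∘ (outside ∷_)) + ∑ₛ n (f ∘ (inside ∷_))

  ∑ₛ-cong : ∀ n {f g} → (∀ S → f S ≡ g S) → ∑ₛ n f ≡ ∑ₛ n g
  ∑ₛ-cong zero    f≡g = f≡g []
  ∑ₛ-cong (suc n) f≡g = cong₂ _+_ (∑ₛ-cong n (f≡g ∘ (outside ∷_))) (∑ₛ-cong n (f≡g ∘ (inside ∷_)))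

  ∑ₛ-mono : ∀ n {f g} → (∀ S → f S ≤ g S) → ∑ₛ n f ≤ ∑ₛ n g
  ∑ₛ-mono zero    f≤g = f≤g []
  ∑ₛ-mono (suc n) f≤g = +-mono-≤ (∑ₛ-mono n (f≤g ∘ (outside ∷_))) (∑ₛ-mono n (f≤g ∘ (inside ∷_)))

  ∑ₛ-zero : ∀ n → ∑ₛ n (λ _ → 0) ≡ 0
  ∑ₛ-zero zero    = refl
  ∑ₛ-zero (suc n) = cong₂ _+_ (∑ₛ-zero n) (∑ₛ-zero n)

  interchange : ∀ a b c e → (a + b) + (c + e) ≡ (a + c) + (b + e)
  interchange = solve-∀

  ∑ₛ-+ : ∀ n f g → ∑ₛ n (λ S → f S + g S) ≡ ∑ₛ n f + ∑ₛ n g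
  ∑ₛ-+ zero    f g = refl
  ∑ₛ-+ (suc n) f g = trans
    (cong₂ _+_ (∑ₛ-+ n (f ∘ (outside ∷_)) (g ∘ (outside ∷_))) (∑ₛ-+ n (f ∘ (inside ∷_)) (g ∘ (inside ∷_))))
    (interchange (∑ₛ n (f ∘ (outside ∷_))) _ _ _)

  ∑ₛ-* : ∀ n a f → ∑ₛ n (λ S → a * f S) ≡ a * ∑ₛ n f
  ∑ₛ-* zero    a f = refl
  ∑ₛ-* (suc n) a f = trans (cong₂ _+_ (∑ₛ-* n a (f ∘ (outside ∷_))) (∑ₛ-* n a (f ∘ (inside ∷_)))) (sym (*-distribˡ-+ a (∑ₛ n (f ∘ (outside ∷_))) _))

  ∑ₛ-∑ : ∀ n {m} (f : Fin m → Subset n → ℕ) → ∑ₛ n (λ S → ∑ (λ i → f i S)) ≡ ∑ (λ i → ∑ₛ n (f i))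
  ∑ₛ-∑ n {zero}  f = ∑ₛ-zero n
  ∑ₛ-∑ n {suc m} f = trans (∑ₛ-+ n (f zero) _) (cong (∑ₛ n (f zero) +_) (∑ₛ-∑ n (f ∘ suc)))

  ∑ₛ-sum : ∀ n {A : Set} (f : A → Subset n → ℕ) xs →
           ∑ₛ n (λ S → sum (List.map (λ x → f x S) xs)) ≡ sum (List.map (λ x → ∑ₛ n (f x)) xs)
  ∑ₛ-sum n f []       = ∑ₛ-zero n
  ∑ₛ-sum n f (x ∷ xs) = trans (∑ₛ-+ n (f x) _) (cong (∑ₛ n (f x) +_) (∑ₛ-sum n f xs))

  ∑ₛ-take-drop : ∀ m n (f : Subset m → ℕ) (g : Subset n → ℕ) →
                 ∑ₛ (m + n) (λ S → f (take m S) * g (drop m S)) ≡ ∑ₛ m f * ∑ₛ n g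
  ∑ₛ-take-drop zero    n f g = ∑ₛ-* n (f []) g
  ∑ₛ-take-drop (suc m) n f g = trans
    (cong₂ _+_ (∑ₛ-take-drop m n (f ∘ (outside ∷_)) g) (∑ₛ-take-drop m n (f ∘ (inside ∷_)) g))
    (sym (*-distribʳ-+ (∑ₛ n g) (∑ₛ m (f ∘ (outside ∷_))) _))

  length-filter : {A : Set} {R : A → Set} (R? : Decidable R) (xs : List A) →
                  length (filter R? xs) ≡ sum (List.map (indicator ∘ R?) xs)
  length-filter R? []       = refl
  length-filter R? (x ∷ xs) with R? x
  ... | yes _ = cong suc (length-filter R? xs)
  ... | no  _ = length-filter R? xs

  sum-subsets : ∀ n (f : Subset n → ℕ) → sum (List.map f (subsets {d} n)) ≡ ∑ₛ n f
  sum-subsets         zero    f = +-identityʳ (f [])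
  sum-subsets {d = d} (suc n) f = begin
    sum (List.map f (List.map (outside ∷_) S List.++ List.map (inside ∷_) S))
      ≡⟨ cong sum (List.map-++ f (List.map (outside ∷_) S) _) ⟩
    sum (List.map f (List.map (outside ∷_) S) List.++ List.map f (List.map (inside ∷_) S))
      ≡⟨ sum-++ (List.map f (List.map (outside ∷_) S)) _ ⟩
    sum (List.map f (List.map (outside ∷_) S)) + sum (List.map f (List.map (inside ∷_) S))
      ≡⟨ cong₂ (λ xs ys → sum xs + sum ys) (List.map-∘ S) (List.map-∘ S) ⟨
    sum (List.map (f ∘ (outside ∷_)) S) + sum (List.map (f ∘ (inside ∷_)) S)
      ≡⟨ cong₂ _+_ (sum-subsets {d} n _) (sum-subsets {d} n _) ⟩
    ∑ₛ (suc n) f ∎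
    where
    open ≡-Reasoning
    S = subsets {d} n

  sized : ∀ n k → ℕ
  sized n k = ∑ₛ n (λ S → indicator (∣ S ∣ ≟ k))

  sized-suc-suc : ∀ n k → sized (suc n) (suc k) ≡ sized n (suc k) + sized n k
  sized-suc-suc n k = cong (sized n (suc k) +_)
    (∑ₛ-cong n λ S → indicator-cong (suc ∣ S ∣ ≟ suc k) (∣ S ∣ ≟ k) suc-injective (cong suc))

  sized-suc-zero : ∀ n → sized (suc n) 0 ≡ sized n 0
  sized-suc-zero n = trans (cong (sized n 0 +_) (∑ₛ-zero n)) (+-identityʳ _)

  sized-zero : ∀ n → sized n 0 ≡ 1
  sized-zero zero    = refl
  sized-zero (suc n) = trans (sized-suc-zero n) (sized-zero n)

  sized-one : ∀ n → sized n 1 ≡ n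
  sized-one zero    = refl
  sized-one (suc n) = trans (sized-suc-suc n 0)
    (trans (cong₂ _+_ (sized-one n) (sized-zero n)) (+-comm n 1))

  sized≡C : ∀ n k → sized n k ≡ n C k
  sized≡C n       zero    = sized-zero n
  sized≡C zero    (suc k) = refl
  sized≡C (suc n) (suc k) = begin
    sized (suc n) (suc k)         ≡⟨ sized-suc-suc n k ⟩
    sized n (suc k) + sized n k   ≡⟨ cong₂ _+_ (sized≡C n (suc k)) (sized≡C n k) ⟩
    n C suc k + n C k             ≡⟨ +-comm (n C suc k) (n C k) ⟩
    n C k + n C suc k             ≡⟨ nCk+nC[k+1]≡[n+1]C[k+1] n k ⟩
    suc n C suc k                 ∎
    where open ≡-Reasoning

  -- The recurrence (n+1)^(k+1) = n (n+1)^k + (n+1)^k dominates Pascal's rule term by term.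
  sized≤^ : ∀ n k → sized n k ≤ n ^ k
  sized≤^ n       zero    = ≤-reflexive (sized-zero n)
  sized≤^ zero    (suc k) = z≤n
  sized≤^ (suc n) (suc k) = begin
    sized (suc n) (suc k)              ≡⟨ sized-suc-suc n k ⟩
    sized n (suc k) + sized n k        ≤⟨ +-mono-≤ (sized≤^ n (suc k)) (sized≤^ n k) ⟩
    n * n ^ k + n ^ k                  ≤⟨ +-mono-≤ (*-monoʳ-≤ n n^k≤) n^k≤ ⟩
    n * suc n ^ k + suc n ^ k          ≡⟨ +-comm (n * suc n ^ k) _ ⟩
    suc n ^ suc k                      ∎
    where
    open ≤-Reasoning
    n^k≤ = ^-monoˡ-≤ k (n≤1+n n)

  -- Copies as sums over leaf sets, and the recursive inequality at a node.

  module _ {d : ℕ} where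

    ≅⁺-trans : {t u v : NonemptyTree d} → t ≅⁺ u → u ≅⁺ v → t ≅⁺ v
    ≅⁺-trans leaf       leaf       = leaf
    ≅⁺-trans (node σ f) (node τ g) = node (σ ∘ₚ τ) λ i → ≅⁺-trans (f i) (g (σ ⟨$⟩ʳ i))

    ≅-trans : {T U V : Tree d} → T ≅ U → U ≅ V → T ≅ V
    ≅-trans = Maybe.trans ≅⁺-trans

    leaves*-∑ : (ts : List (NonemptyTree d)) → leaves* ts ≡ ∑ (λ i → leaves (lookup ts i))
    leaves*-∑ []       = refl
    leaves*-∑ (t ∷ ts) = cong (leaves t +_) (leaves*-∑ ts)

    ≅⁺⇒leaves≡ : {t u : NonemptyTree d} → t ≅⁺ u → leaves t ≡ leaves u
    ≅⁺⇒leaves≡ leaf = refl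
    ≅⁺⇒leaves≡ (node {ts} {us} σ f) = begin
      leaves* ts                               ≡⟨ leaves*-∑ ts ⟩
      ∑ (λ i → leaves (lookup ts i))           ≡⟨ ∑-cong (λ i → ≅⁺⇒leaves≡ (f i)) ⟩
      ∑ (λ i → leaves (lookup us (σ ⟨$⟩ʳ i)))  ≡⟨ ∑-permute (λ i → leaves (lookup us i)) σ ⟨
      ∑ (λ i → leaves (lookup us i))           ≡⟨ leaves*-∑ us ⟨
      leaves* us                               ∎
      where open ≡-Reasoning

    ≅⇒‖‖≡ : {T U : Tree d} → T ≅ U → ‖ T ‖ ≡ ‖ U ‖
    ≅⇒‖‖≡ (just t≅u) = ≅⁺⇒leaves≡ t≅u
    ≅⇒‖‖≡ nothing    = refl

    ∣take∣+∣drop∣ : ∀ m {n} (S : Subset (m + n)) → ∣ take m S ∣ + ∣ drop m S ∣ ≡ ∣ S ∣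
    ∣take∣+∣drop∣ zero    S             = refl
    ∣take∣+∣drop∣ (suc m) (outside ∷ S) = ∣take∣+∣drop∣ m S
    ∣take∣+∣drop∣ (suc m) (inside  ∷ S) = cong suc (∣take∣+∣drop∣ m S)

    ‖graft‖ : ∀ us (us≤d : length us ≤ d) → ‖ graft us us≤d ‖ ≡ leaves* us
    ‖graft‖ []          _ = refl
    ‖graft‖ (u ∷ [])    _ = sym (+-identityʳ (leaves u))
    ‖graft‖ (_ ∷ _ ∷ _) _ = refl

    ‖induced⁺‖ : (t : NonemptyTree d) (S : Subset (leaves t)) → ‖ induced⁺ t S ‖ ≡ ∣ S ∣
    leaves*-induced* : (ts : List (NonemptyTree d)) (S : Subset (leaves* ts)) →
                       leaves* (proj₁ (induced* ts S)) ≡ ∣ S ∣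
    ‖induced⁺‖ leaf (outside ∷ []) = refl
    ‖induced⁺‖ leaf (inside  ∷ []) = refl
    ‖induced⁺‖ (node ts _ _) S = trans (‖graft‖ (proj₁ (induced* ts S)) _) (leaves*-induced* ts S)
    leaves*-induced* []       [] = refl
    leaves*-induced* (t ∷ ts) S
      with induced⁺ t (take (leaves t) S) | induced* ts (drop (leaves t) S)
         | ‖induced⁺‖ t (take (leaves t) S) | leaves*-induced* ts (drop (leaves t) S)
    ... | nothing | us , _ | 0≡  | us≡ = trans (cong₂ _+_ 0≡ us≡) (∣take∣+∣drop∣ (leaves t) S)
    ... | just u  | us , _ | u≡  | us≡ = trans (cong₂ _+_ u≡ us≡) (∣take∣+∣drop∣ (leaves t) S)

    ‖induced‖ : (T : Tree d) (S : Subset ‖ T ‖) → ‖ induced T S ‖ ≡ ∣ S ∣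
    ‖induced‖ nothing  [] = refl
    ‖induced‖ (just t) S  = ‖induced⁺‖ t S

    -- The size condition inside `copies` follows from the isomorphism: an induced tree has as many
    -- leaves as were chosen, and isomorphic trees have equally many leaves.
    copies-∑ₛ : (D T : Tree d) → copies D T ≡ ∑ₛ (‖ T ‖) (λ S → indicator (induced T S ≅? D))
    copies-∑ₛ D T = trans (length-filter _ (subsets {d} (‖ T ‖))) (trans (sum-subsets {d} (‖ T ‖) _)
      (∑ₛ-cong (‖ T ‖) λ S → indicator-cong _ (induced T S ≅? D) proj₂
        λ iso → trans (sym (‖induced‖ T S)) (≅⇒‖‖≡ iso) , iso))

    copies≤sized : (D T : Tree d) → copies D T ≤ sized (‖ T ‖) (‖ D ‖)
    copies≤sized D T = subst (_≤ sized (‖ T ‖) (‖ D ‖)) (sym (copies-∑ₛ D T)) (∑ₛ-mono (‖ T ‖) λ S →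
      indicator-mono (induced T S ≅? D) (∣ S ∣ ≟ ‖ D ‖) (trans (sym (‖induced‖ T S)) ∘ ≅⇒‖‖≡))

    -- The trivial bound, used wherever an inducibility gives no information: small hosts, branches
    -- with at most one leaf, and the base cases of the induction.
    copies≤^ : (D T : Tree d) → copies D T ≤ ‖ T ‖ ^ ‖ D ‖
    copies≤^ D T = ≤-trans (copies≤sized D T) (sized≤^ (‖ T ‖) (‖ D ‖))

    copies≤C : (D T : Tree d) → copies D T ≤ (‖ T ‖) C (‖ D ‖)
    copies≤C D T = subst (copies D T ≤_) (sized≡C (‖ T ‖) (‖ D ‖)) (copies≤sized D T)

    1≤leaves : (t : NonemptyTree d) → 1 ≤ leaves t
    1≤leaves leaf                  = ≤-refl
    1≤leaves (node (t ∷ ts) 2≤ _) = ≤-trans (1≤leaves t) (m≤m+n (leaves t) _)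

    leaves≡1⇒leaf : (t : NonemptyTree d) → leaves t ≡ 1 → t ≅⁺ leaf
    leaves≡1⇒leaf leaf _ = leaf
    leaves≡1⇒leaf (node (_ ∷ []) (s≤s ()) _) _
    leaves≡1⇒leaf (node (t ∷ u ∷ ts) _ _) eq = ⊥-elim (<-irrefl (sym eq)
      (+-mono-≤ (1≤leaves t) (≤-trans (1≤leaves u) (m≤m+n (leaves u) _))))

    ‖‖≡1⇒leaf : (T : Tree d) → ‖ T ‖ ≡ 1 → T ≅ just leaf
    ‖‖≡1⇒leaf (just t) eq = just (leaves≡1⇒leaf t eq)

    ‖‖≤copies-leaf : (T : Tree d) → ‖ T ‖ ≤ copies (just leaf) T
    ‖‖≤copies-leaf T = begin
      ‖ T ‖                                                     ≡⟨ sized-one (‖ T ‖) ⟨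
      sized (‖ T ‖) 1                                             ≤⟨ ∑ₛ-mono (‖ T ‖) (λ S →
        indicator-mono (∣ S ∣ ≟ 1) (induced T S ≅? just leaf) (‖‖≡1⇒leaf (induced T S) ∘ trans (‖induced‖ T S))) ⟩
      ∑ₛ (‖ T ‖) (λ S → indicator (induced T S ≅? just leaf))     ≡⟨ copies-∑ₛ (just leaf) T ⟨
      copies (just leaf) T                                      ∎
      where open ≤-Reasoning

    -- `padded` has d as an implicit argument that its type does not determine.
    pad : List A → Fin n → Maybe A
    pad = padded {d}

    -- Keeps what `S` induces in branch `i` at position `i`, whereas `induced*` drops empty results
    -- and thereby loses the positions.
    part : (ts : List (NonemptyTree d)) → Subset (leaves* ts) → Fin n → Tree d
    part []       S i       = nothing
    part (t ∷ ts) S zero    = induced⁺ t (take (leaves t) S)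
    part (t ∷ ts) S (suc i) = part ts (drop (leaves t) S) i

    -- The choices in different branches are independent, so the sum of products factors. The bound
    -- on `length ts` ensures that every leaf lies in one of the `n` branches counted.
    ∑ₛ-part : ∀ ts (B : Fin n → Tree d) → length ts ≤ n →
              ∑ₛ (leaves* ts) (λ S → ∏ (λ i → indicator (part ts S i ≅? B i))) ≡
              ∏ (λ i → copies (B i) (pad ts i))
    ∑ₛ-part {n = zero}  []       B _ = refl
    ∑ₛ-part {n = suc n} []       B _ =
      cong₂ _*_ (sym (copies-∑ₛ (B zero) nothing)) (∑ₛ-part [] (B ∘ suc) z≤n)
    ∑ₛ-part {n = suc n} (t ∷ ts) B (s≤s ts≤n) = trans
      (∑ₛ-take-drop (leaves t) (leaves* ts) _ _)
      (cong₂ _*_ (sym (copies-∑ₛ (B zero) (just t))) (∑ₛ-part ts (B ∘ suc) ts≤n))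

    -- Presents a copy of `D` lying wholly in branch `j` as a family of targets, one per branch, so
    -- that `∑ₛ-part` counts these copies too.
    single : Tree d → Fin n → Fin n → Tree d
    single D zero    zero    = D
    single D zero    (suc _) = nothing
    single D (suc _) zero    = nothing
    single D (suc j) (suc i) = single D j i

    ∏-copies-empty : (T : Fin n → Tree d) → ∏ (λ i → copies nothing (T i)) ≤ 1
    ∏-copies-empty {n = zero}  T = ≤-refl
    ∏-copies-empty {n = suc n} T = *-mono-≤ (copies≤^ nothing (T zero)) (∏-copies-empty (T ∘ suc))

    ∏-copies-single : ∀ D (j : Fin n) (T : Fin n → Tree d) →
                      ∏ (λ i → copies (single D j i) (T i)) ≤ copies D (T j)
    ∏-copies-single D zero    T = ≤-trans
      (*-monoʳ-≤ (copies D (T zero)) (∏-copies-empty (T ∘ suc))) (≤-reflexive (*-identityʳ _))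
    ∏-copies-single D (suc j) T = ≤-trans
      (*-mono-≤ (copies≤^ nothing (T zero)) (∏-copies-single D j (T ∘ suc))) (≤-reflexive (*-identityˡ _))

    part-empty : ∀ ts (S : Subset (leaves* ts)) → proj₁ (induced* ts S) ≡ [] →
                 (i : Fin n) → part ts S i ≡ nothing
    part-empty []       S eq i = refl
    part-empty (t ∷ ts) S eq i
      with induced⁺ t (take (leaves t) S) in eq₁ | induced* ts (drop (leaves t) S) in eq₂
    part-empty (t ∷ ts) S eq zero    | nothing | us , _ = eq₁
    part-empty (t ∷ ts) S eq (suc i) | nothing | us , _ =
      part-empty ts (drop (leaves t) S) (trans (cong proj₁ eq₂) eq) i

    part-single : ∀ ts (S : Subset (leaves* ts)) {u D} → proj₁ (induced* ts S) ≡ u ∷ [] →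
                  length ts ≤ n → just u ≅ D →
                  ∃ λ (j : Fin n) → ∀ i → part ts S i ≅ single D j i
    part-single {n = suc n} (t ∷ ts) S eq (s≤s ts≤n) u≅D
      with induced⁺ t (take (leaves t) S) in eq₁ | induced* ts (drop (leaves t) S) in eq₂
    ... | just u | us , _ with refl ← eq = zero , λ where
      zero    → subst (_≅ _) (sym eq₁) u≅D
      (suc i) → subst (_≅ nothing) (sym (part-empty ts (drop (leaves t) S) (cong proj₁ eq₂) i)) nothing
    ... | nothing | us , _
      with j , p ← part-single ts (drop (leaves t) S) (trans (cong proj₁ eq₂) eq) ts≤n u≅D =
      suc j , λ where
        zero    → subst (_≅ nothing) (sym eq₁) nothing
        (suc i) → p i

    padded-inject₁ : (xs : List A) (i : Fin n) → pad xs (inject₁ i) ≡ pad xs i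
    padded-inject₁ []       i       = refl
    padded-inject₁ (x ∷ xs) zero    = refl
    padded-inject₁ (x ∷ xs) (suc i) = padded-inject₁ xs i

    padded-last : (xs : List A) → length xs ≤ n → pad xs (fromℕ n) ≡ nothing
    padded-last []                      _         = refl
    padded-last {n = suc n} (x ∷ xs) (s≤s xs≤n) = padded-last xs xs≤n

    padded-lookup : (xs : List A) (i : Fin (length xs)) → pad xs i ≡ just (lookup xs i)
    padded-lookup (x ∷ xs) zero    = refl
    padded-lookup (x ∷ xs) (suc i) = padded-lookup xs i

    punchIn-fromℕ : (i : Fin n) → punchIn (fromℕ n) i ≡ inject₁ i
    punchIn-fromℕ zero    = refl
    punchIn-fromℕ (suc i) = cong suc (punchIn-fromℕ i)

    -- An isomorphism of nodes matches only actual children, whereas `_∼[_]_` speaks of permutations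
    -- of all `d` branches, empty ones included; bijections of padded lists mediate between the two.
    Matching : (R : A → B → Set) → List A → List B → ℕ → ℕ → Set
    Matching R xs ys m n =
      Σ (Permutation m n) λ σ → ∀ i → Maybe.Pointwise R (pad xs i) (pad ys (σ ⟨$⟩ʳ i))

    fromℕ-or-inject₁ : (P : Fin (suc n) → Set) → P (fromℕ n) → (∀ i → P (inject₁ i)) → ∀ i → P i
    fromℕ-or-inject₁ {n = zero}  P pₙ p zero    = pₙ
    fromℕ-or-inject₁ {n = suc n} P pₙ p zero    = p zero
    fromℕ-or-inject₁ {n = suc n} P pₙ p (suc i) = fromℕ-or-inject₁ (P ∘ suc) pₙ (p ∘ suc) i

    insert-last : ∀ {m n} (σ : Permutation m n) → Perm.insert (fromℕ m) (fromℕ n) σ ⟨$⟩ʳ fromℕ m ≡ fromℕ n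
    insert-last {m} σ with fromℕ m Fin.≟ fromℕ m
    ... | yes _ = refl
    ... | no ≢  = ⊥-elim (≢ refl)

    Matching-suc : ∀ {R : A → B → Set} xs ys {m n} → length xs ≤ m → length ys ≤ n →
                   Matching R xs ys m n → Matching R xs ys (suc m) (suc n)
    Matching-suc {R = R} xs ys {m} {n} xs≤m ys≤n (σ , f) = σ⁺ , fromℕ-or-inject₁ _
      (subst₂ (Maybe.Pointwise R) (sym (padded-last xs xs≤m))
        (sym (trans (cong (pad ys) (insert-last σ)) (padded-last ys ys≤n))) nothing)
      λ i → subst₂ (Maybe.Pointwise R) (sym (padded-inject₁ xs i))
        (sym (trans (cong (pad ys) (σ⁺-inject₁ i)) (padded-inject₁ ys (σ ⟨$⟩ʳ i)))) (f i)
      where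
      σ⁺ = Perm.insert (fromℕ m) (fromℕ n) σ
      σ⁺-inject₁ : ∀ i → σ⁺ ⟨$⟩ʳ inject₁ i ≡ inject₁ (σ ⟨$⟩ʳ i)
      σ⁺-inject₁ i = trans (cong (σ⁺ ⟨$⟩ʳ_) (sym (punchIn-fromℕ i)))
        (trans (Perm.insert-punchIn (fromℕ m) (fromℕ n) σ i) (punchIn-fromℕ (σ ⟨$⟩ʳ i)))

    Matching-lookup : ∀ {R : A → B → Set} xs ys (σ : Permutation (length xs) (length ys)) →
                      (∀ i → R (lookup xs i) (lookup ys (σ ⟨$⟩ʳ i))) →
                      ∀ r → Matching R xs ys (r + length xs) (r + length ys)
    Matching-lookup {R = R} xs ys σ f zero    = σ , λ i →
      subst₂ (Maybe.Pointwise R) (sym (padded-lookup xs i)) (sym (padded-lookup ys (σ ⟨$⟩ʳ i))) (just (f i))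
    Matching-lookup xs ys σ f (suc r) = Matching-suc xs ys (m≤n+m _ r) (m≤n+m _ r) (Matching-lookup xs ys σ f r)

    Matching-padded : ∀ {R : A → B → Set} xs ys (σ : Permutation (length xs) (length ys)) →
                      (∀ i → R (lookup xs i) (lookup ys (σ ⟨$⟩ʳ i))) →
                      length xs ≤ n → Matching R xs ys n n
    Matching-padded {n = n} {R = R} xs ys σ f xs≤n = subst₂ (Matching R xs ys)
      -- The bijection `σ` forces equal lengths, so both lists receive the same number of padding
      -- entries.
      (m∸n+n≡m xs≤n) (trans (cong (n ∸ length xs +_) (sym (Perm.↔⇒≡ σ))) (m∸n+n≡m xs≤n))
      (Matching-lookup xs ys σ f (n ∸ length xs))

    part-permute : ∀ ts (S : Subset (leaves* ts)) → length ts ≤ n →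
                   ∃ λ (ρ : Permutation′ n) → ∀ i → part ts S i ≡ pad (proj₁ (induced* ts S)) (ρ ⟨$⟩ʳ i)
    part-permute []       S _ = Perm.id , λ _ → refl
    part-permute {n = suc n} (t ∷ ts) S (s≤s ts≤n)
      with induced⁺ t (take (leaves t) S) in eq₁ | induced* ts (drop (leaves t) S) in eq₂
         | part-permute ts (drop (leaves t) S) ts≤n
    ... | just u  | us , us≤ | ρ , p = Perm.lift₀ ρ , λ where
      zero    → eq₁
      (suc i) → p i
    -- A pruned position is sent to the last index, which is padding because `us` has at most `n`
    -- entries.
    ... | nothing | us , us≤ | ρ , p = Perm.insert zero (fromℕ n) ρ , λ where
      zero    → trans eq₁ (sym (padded-last us (≤-trans us≤ ts≤n)))
      (suc i) → trans (p i) (trans (sym (padded-inject₁ us (ρ ⟨$⟩ʳ i)))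
        (cong (pad us) (sym (trans (Perm.insert-punchIn zero (fromℕ n) ρ i) (punchIn-fromℕ (ρ ⟨$⟩ʳ i))))))

    branch-product : Tree d → List (NonemptyTree d) → Permutation′ d → ℕ
    branch-product D ts π = ∏ (λ i → copies (branches D (π ⟨$⟩ʳ i)) (pad ts i))

    -- For each leaf set that induces `D`, at least one of the indicator products is 1. This
    -- pointwise bound is summed over all leaf sets.
    copies-node : ∀ (D : Tree d) → 2 ≤ ‖ D ‖ → (M : Representatives D) → ∀ ts p ts≤d →
                  copies D (just (node ts p ts≤d)) ≤
                  ∑ {d} (λ j → copies D (pad ts j)) +
                  sum (List.map (branch-product D ts) (Representatives.list M))
    copies-node nothing     ()
    copies-node (just leaf) (s≤s ())
    copies-node D@(just (node Ds 2≤Ds Ds≤d)) _ M ts p ts≤d = begin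
      copies D (just (node ts p ts≤d))
        ≡⟨ copies-∑ₛ D (just (node ts p ts≤d)) ⟩
      ∑ₛ N (λ S → indicator (induced⁺ (node ts p ts≤d) S ≅? D))
        ≤⟨ ∑ₛ-mono N (λ S → indicator≤ (induced⁺ (node ts p ts≤d) S ≅? D) (one S)) ⟩
      ∑ₛ N (λ S → ∑ (λ j → ∏ (within S j)) + sum (List.map (λ π → ∏ (across S π)) L))
        ≡⟨ ∑ₛ-+ N _ _ ⟩
      ∑ₛ N (λ S → ∑ (λ j → ∏ (within S j))) + ∑ₛ N (λ S → sum (List.map (λ π → ∏ (across S π)) L))
        ≡⟨ cong₂ _+_ (∑ₛ-∑ N (λ j S → ∏ (within S j))) (∑ₛ-sum N (λ π S → ∏ (across S π)) L) ⟩
      ∑ (λ j → ∑ₛ N (λ S → ∏ (within S j))) + sum (List.map (λ π → ∑ₛ N (λ S → ∏ (across S π))) L)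
        ≤⟨ +-mono-≤
             (∑-mono λ j → ≤-trans (≤-reflexive (∑ₛ-part ts (single D j) ts≤d)) (∏-copies-single D j (pad ts)))
             (≤-reflexive (cong sum (List.map-cong (λ π → ∑ₛ-part ts (λ i → branches D (π ⟨$⟩ʳ i)) ts≤d) L))) ⟩
      ∑ {d} (λ j → copies D (pad ts j)) + sum (List.map (branch-product D ts) L) ∎
      where
      open ≤-Reasoning
      L = Representatives.list M
      N = leaves* ts
      within : Subset N → Fin d → Fin d → ℕ
      within S j i = indicator (part ts S i ≅? single D j i)
      across : Subset N → Permutation′ d → Fin d → ℕ
      across S π i = indicator (part ts S i ≅? branches D (π ⟨$⟩ʳ i))

      one : ∀ S → induced⁺ (node ts p ts≤d) S ≅ D →
            1 ≤ ∑ (λ j → ∏ (within S j)) + sum (List.map (λ π → ∏ (across S π)) L)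
      one S iso with induced* ts S in eq
      -- `graft` suppresses a root with one child, so the only surviving branch already carries the
      -- whole copy.
      one S (just iso) | u ∷ [] , us≤ with part-single ts S (cong proj₁ eq) ts≤d (just iso)
      ... | j , f = ≤-trans
        (≤-trans (1≤∏ (λ i → 1≤indicator (part ts S i ≅? single D j i) (f i))) (term≤∑ (λ j → ∏ (within S j)) j))
        (m≤m+n _ _)
      -- `ρ` sends each position to its place in the pruned list, and `τ` extends the isomorphism at
      -- the root to the empty branches. A representative equivalent to their composite assigns
      -- isomorphic branches to every position.
      one S (just (node σ f)) | us@(_ ∷ _ ∷ _) , us≤
        with ρ , g ← part-permute ts S ts≤d
           | τ , h ← Matching-padded us Ds σ f (≤-trans us≤ ts≤d) =
        ≤-trans (term≤sum (λ π → ∏ (across S π)) (Any.map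
          (λ {π} ∼π → 1≤∏ λ i → 1≤indicator (part ts S i ≅? branches D (π ⟨$⟩ʳ i))
            (≅-trans (subst (_≅ pad Ds (ρ ∘ₚ τ ⟨$⟩ʳ i))
              (sym (trans (g i) (cong (λ v → pad (proj₁ v) (ρ ⟨$⟩ʳ i)) eq))) (h (ρ ⟨$⟩ʳ i))) (∼π i)))
          (Representatives.exhaustive M (ρ ∘ₚ τ))))
          (m≤n+m _ _)

-- Polynomial inequalities over the natural numbers.

module Estimates where

  open import Data.Bool.Base using (true)
  open import Data.Fin.Base using (Fin; zero; suc; punchIn)
  open import Data.List.Base using (List; []; _∷_; length)
  open import Data.Maybe.Base using (just)
  open import Data.Nat.Base
  open import Data.Nat.Combinatorics using (_P_; _C_; k>n⇒nCk≡0; nCk≡nPk/k!; k![n∸k]!∣n!; nPk≡n!/[n∸k]!)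
  open import Data.Nat.Combinatorics.Base using (_P′_)
  open import Data.Nat.Divisibility using (_∣_; m*n∣o⇒m∣o/n)
  open import Data.Nat.Properties
  open import Data.Nat.Tactic.RingSolver using (solve-∀)
  open import Data.Product.Base using (∃; _,_)
  open import Function.Base using (_∘_)
  open import Relation.Binary.PropositionalEquality
  open import Relation.Nullary using (yes; no)
  open import Algebra.Properties.Semiring.Sum +-*-semiring using () renaming (sum-remove to ∑-remove)
  open import Algebra.Properties.CommutativeMonoid.Sum *-1-commutativeMonoid using () renaming (sum-remove to ∏-remove)
  open Counting
  private
    variable
      d n : ℕ

  -- Splitting off xy, x^2 and y^2 leaves factors of degree a + b, each at most (x + y)^(a + b); and
  -- xy + x^2 + y^2 is at most (x + y)^2.
  binomial≥ : ∀ x y a b → x ^ suc a * y ^ suc b + (x ^ (suc a + suc b) + y ^ (suc a + suc b)) ≤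
              (x + y) ^ (suc a + suc b)
  binomial≥ x y a b = begin
    x ^ suc a * y ^ suc b + (x ^ (suc a + suc b) + y ^ (suc a + suc b))
      ≡⟨ cong (λ c → x ^ suc a * y ^ suc b + (x ^ c + y ^ c)) (+-suc (suc a) b) ⟩
    x ^ suc a * y ^ suc b + (x ^ suc (suc (a + b)) + y ^ suc (suc (a + b)))
      ≡⟨ rearrange x y (x ^ a) (y ^ b) (x ^ (a + b)) (y ^ (a + b)) ⟩
    x * y * (x ^ a * y ^ b) + (x * x * x ^ (a + b) + y * y * y ^ (a + b))
      ≤⟨ +-mono-≤ (*-monoʳ-≤ (x * y) mixed) (+-mono-≤ (*-monoʳ-≤ (x * x) (^-monoˡ-≤ (a + b) (m≤m+n x y)))
                                                      (*-monoʳ-≤ (y * y) (^-monoˡ-≤ (a + b) (m≤n+m y x)))) ⟩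
    x * y * s + (x * x * s + y * y * s)
      ≤⟨ m≤m+n _ (x * y * s) ⟩
    x * y * s + (x * x * s + y * y * s) + x * y * s
      ≡⟨ square x y s ⟩
    (x + y) ^ suc (suc (a + b))
      ≡⟨ cong ((x + y) ^_) (+-suc (suc a) b) ⟨
    (x + y) ^ (suc a + suc b) ∎
    where
    open ≤-Reasoning
    s = (x + y) ^ (a + b)
    rearrange : ∀ x y u v w z → (x * u) * (y * v) + (x * (x * w) + y * (y * z)) ≡
              x * y * (u * v) + (x * x * w + y * y * z)
    rearrange = solve-∀
    square : ∀ x y s → x * y * s + (x * x * s + y * y * s) + x * y * s ≡ (x + y) * ((x + y) * s)
    square = solve-∀
    mixed : x ^ a * y ^ b ≤ s
    mixed = begin
      x ^ a * y ^ b              ≤⟨ *-mono-≤ (^-monoˡ-≤ a (m≤m+n x y)) (^-monoˡ-≤ b (m≤n+m y x)) ⟩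
      (x + y) ^ a * (x + y) ^ b  ≡⟨ ^-distribˡ-+-* (x + y) a b ⟨
      s                          ∎

  ∏^≤ : (m e : Fin n → ℕ) → ∏ (λ i → m i ^ e i) ≤ ∑ m ^ ∑ e
  ∏^≤ {zero}  m e = ≤-refl
  ∏^≤ {suc n} m e = begin
    m zero ^ e zero * ∏ (λ i → m (suc i) ^ e (suc i))
      ≤⟨ *-mono-≤ (^-monoˡ-≤ (e zero) (m≤m+n (m zero) (∑ (m ∘ suc))))
                  (≤-trans (∏^≤ (m ∘ suc) (e ∘ suc)) (^-monoˡ-≤ (∑ (e ∘ suc)) (m≤n+m (∑ (m ∘ suc)) (m zero)))) ⟩
    ∑ m ^ e zero * ∑ m ^ ∑ (e ∘ suc)
      ≡⟨ ^-distribˡ-+-* (∑ m) (e zero) _ ⟨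
    ∑ m ^ ∑ e ∎
    where open ≤-Reasoning

  ∑^≤^∑ : ∀ k (m : Fin n → ℕ) → ∑ (λ i → m i ^ suc k) ≤ ∑ m ^ suc k
  ∑^≤^∑ {zero}  k m = z≤n
  ∑^≤^∑ {suc n} k m = begin
    m zero ^ suc k + ∑ (λ i → m (suc i) ^ suc k)
      ≤⟨ +-monoʳ-≤ (m zero ^ suc k) (∑^≤^∑ k (m ∘ suc)) ⟩
    m zero * m zero ^ k + ∑ (m ∘ suc) * ∑ (m ∘ suc) ^ k
      ≤⟨ +-mono-≤ (*-monoʳ-≤ (m zero) (^-monoˡ-≤ k (m≤m+n (m zero) (∑ (m ∘ suc)))))
                  (*-monoʳ-≤ (∑ (m ∘ suc)) (^-monoˡ-≤ k (m≤n+m (∑ (m ∘ suc)) (m zero)))) ⟩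
    m zero * ∑ m ^ k + ∑ (m ∘ suc) * ∑ m ^ k
      ≡⟨ *-distribʳ-+ (∑ m ^ k) (m zero) _ ⟨
    ∑ m ^ suc k ∎
    where open ≤-Reasoning

  -- One factor m j ≤ N is traded for N; what remains is a mixed monomial of the
  -- expansion of (∑ m) ^ K.
  small-branch : ∀ {N K} (m e : Fin n → ℕ) j → 2 ≤ e j → e j < suc K → ∑ e ≡ suc K → m j ≤ N →
                 ∏ (λ i → m i ^ e i) + N * ∑ (λ i → m i ^ K) ≤ N * ∑ m ^ K
  small-branch {suc n} {N} {K} m e j 2≤ej ej≤K ∑e≡ mj≤N
    -- Here `e j` is 2 + a and the other exponents sum to 1 + b, hence K = (1 + a) + (1 + b). Both
    -- exponents stay positive after one factor `m j` has been traded away.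
    with a , eq ← m≤n⇒∃[o]m+o≡n 2≤ej
       | b , eq′ ← m≤n⇒∃[o]m+o≡n (+-cancelˡ-< (e j) 0 (∑ (λ i → e (punchIn j i)))
                     (subst₂ _<_ (sym (+-identityʳ (e j))) (trans (sym ∑e≡) (∑-remove e)) ej≤K))
    with refl ← suc-injective (trans (sym ∑e≡) (trans (∑-remove e) (sym (cong₂ _+_ eq eq′)))) = begin
    ∏ (λ i → m i ^ e i) + N * ∑ (λ i → m i ^ k)
      ≡⟨ cong₂ (λ u v → u + N * v) (∏-remove {i = j} (λ i → m i ^ e i)) (∑-remove {i = j} (λ i → m i ^ k)) ⟩
    x ^ e j * ∏ (λ i → m (punchIn j i) ^ e (punchIn j i)) + N * (x ^ k + ∑ (λ i → m (punchIn j i) ^ k))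
      ≤⟨ +-mono-≤ (*-mono-≤ (≤-reflexive (cong (x ^_) (sym eq))) (≤-trans (∏^≤ (m ∘ punchIn j) (e ∘ punchIn j)) (≤-reflexive (cong (y ^_) (sym eq′)))))
                  (*-monoʳ-≤ N (+-monoʳ-≤ (x ^ k) (∑^≤^∑ (a + suc b) (m ∘ punchIn j)))) ⟩
    x ^ suc (suc a) * y ^ suc b + N * (x ^ k + y ^ k)
      ≤⟨ +-monoˡ-≤ _ (≤-trans (≤-reflexive (*-assoc x _ _)) (*-monoˡ-≤ _ mj≤N)) ⟩
    N * (x ^ suc a * y ^ suc b) + N * (x ^ k + y ^ k)
      ≡⟨ *-distribˡ-+ N (x ^ suc a * y ^ suc b) _ ⟨
    N * (x ^ suc a * y ^ suc b + (x ^ k + y ^ k))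
      ≤⟨ *-monoʳ-≤ N (binomial≥ x y a b) ⟩
    N * (x + y) ^ k
      ≡⟨ cong (λ v → N * v ^ k) (∑-remove {i = j} m) ⟨
    N * ∑ m ^ k ∎
    where
    open ≤-Reasoning
    x = m j
    y = ∑ (λ i → m (punchIn j i))
    k = suc a + suc b

  P′≤^ : ∀ n k → n P′ k ≤ n ^ k
  P′≤^ n zero    = ≤-refl
  P′≤^ n (suc k) = *-mono-≤ (m∸n≤m n k) (P′≤^ n k)

  -- Replacing n by (k+1) + (n ∸ (k+1)) costs (k+1) n^(k+1) in each induction step, and (k+1)^2 +
  -- (k+1) is at most (k+2)^2. Truncated subtraction makes this valid for small n as well.
  ^≤P′+ : ∀ n k → n ^ suc k ≤ n P′ suc k + suc k * suc k * n ^ k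
  ^≤P′+ n zero    = m≤m+n (n * 1) 1
  ^≤P′+ n (suc k) = begin
    n * n ^ suc k
      ≤⟨ *-monoʳ-≤ n (^≤P′+ n k) ⟩
    n * (p + suc k * suc k * n ^ k)
      ≡⟨ expand n p (suc k * suc k) (n ^ k) ⟩
    n * p + suc k * suc k * n ^ suc k
      ≤⟨ +-monoˡ-≤ _ (*-monoˡ-≤ p (m≤n+m∸n n (suc k))) ⟩
    (suc k + (n ∸ suc k)) * p + suc k * suc k * n ^ suc k
      ≡⟨ rearrange (suc k) (n ∸ suc k) p (suc k * suc k * n ^ suc k) ⟩
    (n ∸ suc k) * p + (suc k * p + suc k * suc k * n ^ suc k)
      ≤⟨ +-monoʳ-≤ ((n ∸ suc k) * p) (+-monoˡ-≤ _ (*-monoʳ-≤ (suc k) (P′≤^ n (suc k)))) ⟩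
    (n ∸ suc k) * p + (suc k * n ^ suc k + suc k * suc k * n ^ suc k)
      ≤⟨ +-monoʳ-≤ ((n ∸ suc k) * p) (m≤m+n _ (suc (suc k) * n ^ suc k)) ⟩
    (n ∸ suc k) * p + ((suc k * n ^ suc k + suc k * suc k * n ^ suc k) + suc (suc k) * n ^ suc k)
      ≡⟨ cong ((n ∸ suc k) * p +_) (square k (n ^ suc k)) ⟩
    n P′ suc (suc k) + suc (suc k) * suc (suc k) * n ^ suc k ∎
    where
    open ≤-Reasoning
    p = n P′ suc k
    expand : ∀ n p q s → n * (p + q * s) ≡ n * p + q * (n * s)
    expand = solve-∀
    rearrange : ∀ u v p w → (u + v) * p + w ≡ v * p + (u * p + w)
    rearrange = solve-∀
    square : ∀ k s → (suc k * s + suc k * suc k * s) + suc (suc k) * s ≡ suc (suc k) * suc (suc k) * s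
    square = solve-∀

  nPk≡nP′k : ∀ {n k} → k ≤ n → n P k ≡ n P′ k
  nPk≡nP′k {n} {k} k≤n with k ≤ᵇ n | ≤⇒≤ᵇ k≤n
  ... | true | _ = refl

  nCk*k!≡nP′k : ∀ {n k} → k ≤ n → (n C k) * k ! ≡ n P′ k
  nCk*k!≡nP′k {n} {k} k≤n = begin
    (n C k) * k !               ≡⟨ cong (_* k !) (nCk≡nPk/k! k≤n) ⟩
    ((n P k) / k !) * k !     ≡⟨ m/n*n≡m k!∣nPk ⟩
    n P k                     ≡⟨ nPk≡nP′k k≤n ⟩
    n P′ k                    ∎
    where
    open ≡-Reasoning
    open import Data.Nat.DivMod using (_/_; m/n*n≡m)
    instance
      _ = k !≢0
      _ = (n ∸ k) !≢0
    k!∣nPk : k ! ∣ n P k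
    k!∣nPk = subst (k ! ∣_) (sym (nPk≡n!/[n∸k]! k≤n))
      (m*n∣o⇒m∣o/n (k !) ((n ∸ k) !) (k![n∸k]!∣n! k≤n))

  nCk*k!≤n^k : ∀ n k → (n C k) * k ! ≤ n ^ k
  nCk*k!≤n^k n k with k ≤? n
  ... | yes k≤n = subst (_≤ n ^ k) (sym (nCk*k!≡nP′k k≤n)) (P′≤^ n k)
  ... | no  k≰n = subst (λ c → c * k ! ≤ n ^ k) (sym (k>n⇒nCk≡0 (≰⇒> k≰n))) z≤n

  module _ {d : ℕ} where

    ‖pad‖≤ : (ts : List (NonemptyTree d)) (i : Fin n) → ‖ pad {d} ts i ‖ ≤ leaves* ts
    ‖pad‖≤ []       i       = z≤n
    ‖pad‖≤ (t ∷ ts) zero    = m≤m+n (leaves t) _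
    ‖pad‖≤ (t ∷ ts) (suc i) = ≤-trans (‖pad‖≤ ts i) (m≤n+m _ (leaves t))

    1≤leaves* : ∀ (ts : List (NonemptyTree d)) → 1 ≤ length ts → 1 ≤ leaves* {d} ts
    1≤leaves* (t ∷ ts) _ = ≤-trans (1≤leaves t) (m≤m+n (leaves t) _)

    ‖pad‖< : ∀ (ts : List (NonemptyTree d)) → 2 ≤ length ts → (i : Fin n) → ‖ pad {d} ts i ‖ < leaves* ts
    ‖pad‖< (t ∷ ts) (s≤s 1≤ts) zero    = subst (_≤ leaves* (t ∷ ts)) (+-comm (leaves t) 1) (+-monoʳ-≤ (leaves t) (1≤leaves* ts 1≤ts))
    ‖pad‖< (t ∷ ts) (s≤s 1≤ts) (suc i) = +-mono-≤ (1≤leaves t) (‖pad‖≤ ts i)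

    ∑-‖pad‖ : ∀ (ts : List (NonemptyTree d)) → length ts ≤ n → ∑ (λ (i : Fin n) → ‖ pad {d} ts i ‖) ≡ leaves* ts
    ∑-‖pad‖ {n = zero}  []       _          = refl
    ∑-‖pad‖ {n = suc n} []       _          = ∑-‖pad‖ {n = n} [] z≤n
    ∑-‖pad‖ {n = suc n} (t ∷ ts) (s≤s ts≤n) = cong (leaves t +_) (∑-‖pad‖ ts ts≤n)

    ‖branches‖< : (D : Tree d) → 2 ≤ ‖ D ‖ → ∀ i → ‖ branches D i ‖ < ‖ D ‖
    ‖branches‖< (just leaf)            (s≤s ())
    ‖branches‖< (just (node ts 2≤ts _)) _ i = ‖pad‖< ts 2≤ts i

    ∑-‖branches‖ : (D : Tree d) → 2 ≤ ‖ D ‖ → ∑ (λ i → ‖ branches D i ‖) ≡ ‖ D ‖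
    ∑-‖branches‖ (just leaf)            (s≤s ())
    ∑-‖branches‖ (just (node ts _ ts≤d)) _ = ∑-‖pad‖ ts ts≤d

    -- A supremum over no hosts at all would be 0, so trees of every size are required for the
    -- inducibility of a leaf to be at least 1.
    caterpillar : 2 ≤ d → ∀ n → ∃ λ (t : NonemptyTree d) → leaves t ≡ suc n
    caterpillar 2≤d zero    = leaf , refl
    caterpillar 2≤d (suc n) with t , eq ← caterpillar 2≤d n =
      node (leaf ∷ t ∷ []) ≤-refl 2≤d , cong suc (trans (+-identityʳ (leaves t)) eq)

-- Natural numbers inside the rationals.

module Rationals where

  open import Data.Fin.Base using (Fin; zero; suc)
  open import Data.Fin.Permutation using (Permutation′; _⟨$⟩ʳ_)
  import Data.Fin.Properties as Fin
  import Data.Integer.Base as ℤ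
  import Data.Integer.Properties as ℤ
  open import Data.List.Base as List using (List; []; _∷_; length)
  open import Data.Maybe.Base using (just; nothing)
  open import Data.Nat.Base as ℕ using (ℕ; zero; suc; _!)
  open import Data.Nat.ListAction using (sum)
  import Data.Nat.Properties as ℕ
  open import Data.Product.Base using (∃; _,_)
  open import Data.Rational.Base as ℚ using (ℚ; 0ℚ; 1ℚ; _+_; _*_; -_; _-_; _≤_; _<_)
  import Data.Rational.Properties as ℚ
  open import Data.Rational.Solver using (module +-*-Solver)
  import Data.Rational.Unnormalised.Base as ℚᵘ
  import Data.Rational.Unnormalised.Properties as ℚᵘ
  open import Data.Sum.Base using (_⊎_; inj₁; inj₂)
  open import Function.Base using (_∘_)
  open import Relation.Binary.PropositionalEquality
  open import Relation.Nullary using (yes; no)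
  open import Relation.Nullary.Decidable using (_×-dec_)
  open import Algebra.Properties.CommutativeMonoid.Sum ℚ.*-1-commutativeMonoid using ()
    renaming (sum to ∏ℚ; sum-permute to ∏ℚ-permute; ∑-distrib-+ to ∏ℚ-distrib-*) public
  open +-*-Solver using (solve; _:=_; _:+_; _:*_; _:-_; :-_)
  open Counting
  open Estimates
  private
    variable
      d n : ℕ
      X : Set

  fromℚᵘ-homo-+ : ∀ p q → ℚ.fromℚᵘ (p ℚᵘ.+ q) ≡ ℚ.fromℚᵘ p + ℚ.fromℚᵘ q
  fromℚᵘ-homo-+ p q = ℚ.toℚᵘ-injective (ℚᵘ.≃-trans (ℚ.toℚᵘ-fromℚᵘ (p ℚᵘ.+ q))
    (ℚᵘ.≃-sym (ℚᵘ.≃-trans (ℚ.toℚᵘ-homo-+ (ℚ.fromℚᵘ p) (ℚ.fromℚᵘ q))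
      (ℚᵘ.+-cong (ℚ.toℚᵘ-fromℚᵘ p) (ℚ.toℚᵘ-fromℚᵘ q)))))

  fromℚᵘ-homo-* : ∀ p q → ℚ.fromℚᵘ (p ℚᵘ.* q) ≡ ℚ.fromℚᵘ p * ℚ.fromℚᵘ q
  fromℚᵘ-homo-* p q = ℚ.toℚᵘ-injective (ℚᵘ.≃-trans (ℚ.toℚᵘ-fromℚᵘ (p ℚᵘ.* q))
    (ℚᵘ.≃-sym (ℚᵘ.≃-trans (ℚ.toℚᵘ-homo-* (ℚ.fromℚᵘ p) (ℚ.fromℚᵘ q))
      (ℚᵘ.*-cong (ℚ.toℚᵘ-fromℚᵘ p) (ℚ.toℚᵘ-fromℚᵘ q)))))

  abstract
    -- Defined through unnormalised fractions, where the homomorphism laws are immediate, and opaque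
    -- so that large terms never unfold into normalised fractions.
    ι : ℕ → ℚ
    ι n = ℚ.fromℚᵘ (ℚᵘ.mkℚᵘ (ℤ.+ n) 0)

    ι-0 : ι 0 ≡ 0ℚ
    ι-0 = refl

    ι-1 : ι 1 ≡ 1ℚ
    ι-1 = refl

    ι-+ : ∀ m n → ι (m ℕ.+ n) ≡ ι m + ι n
    ι-+ m n = trans
      (cong (λ z → ℚ.fromℚᵘ (ℚᵘ.mkℚᵘ z 0)) (trans (ℤ.pos-+ m n)
        (sym (cong₂ ℤ._+_ (ℤ.*-identityʳ (ℤ.+ m)) (ℤ.*-identityʳ (ℤ.+ n))))))
      (fromℚᵘ-homo-+ (ℚᵘ.mkℚᵘ (ℤ.+ m) 0) (ℚᵘ.mkℚᵘ (ℤ.+ n) 0))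

    ι-* : ∀ m n → ι (m ℕ.* n) ≡ ι m * ι n
    ι-* m n = trans (cong (λ z → ℚ.fromℚᵘ (ℚᵘ.mkℚᵘ z 0)) (ℤ.pos-* m n))
      (fromℚᵘ-homo-* (ℚᵘ.mkℚᵘ (ℤ.+ m) 0) (ℚᵘ.mkℚᵘ (ℤ.+ n) 0))

    0≤ι : ∀ n → 0ℚ ≤ ι n
    0≤ι n = ℚ.nonNegative⁻¹ (ι n) {{ℚ.normalize-nonNeg n 1}}

    0<ι : ∀ n → 1 ℕ.≤ n → 0ℚ < ι n
    0<ι (suc n) _ = ℚ.positive⁻¹ (ι (suc n)) {{ℚ.normalize-pos (suc n) 1}}

    /-*-ι : ∀ c b .{{_ : ℕ.NonZero b}} → (ℤ.+ c ℚ./ b) * ι b ≡ ι c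
    /-*-ι c b@(suc b-1) = trans (sym (fromℚᵘ-homo-* (ℚᵘ.mkℚᵘ (ℤ.+ c) b-1) (ℚᵘ.mkℚᵘ (ℤ.+ b) 0)))
      (ℚ.fromℚᵘ-cong {ℚᵘ.mkℚᵘ (ℤ.+ c) b-1 ℚᵘ.* ℚᵘ.mkℚᵘ (ℤ.+ b) 0} {ℚᵘ.mkℚᵘ (ℤ.+ c) 0} (ℚᵘ.*≡* (trans (ℤ.*-identityʳ (ℤ.+ c ℤ.* ℤ.+ b))
        (cong (λ v → ℤ.+ c ℤ.* ℤ.+ v) (sym (ℕ.*-identityʳ b))))))

    -- The absolute value of the numerator suffices, because the denominator is at least 1.
    archimedean : ∀ q → ∃ λ n → q ≤ ι n
    archimedean q = ℤ.∣ ℚ.↥ q ∣ , ℚ.toℚᵘ-cancel-≤ (ℚᵘ.≤-respʳ-≃ (ℚᵘ.≃-sym (ℚ.toℚᵘ-fromℚᵘ (ℚᵘ.mkℚᵘ (ℤ.+ ℤ.∣ ℚ.↥ q ∣) 0))) (bound q))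
      where
      bound : ∀ q → ℚ.toℚᵘ q ℚᵘ.≤ ℚᵘ.mkℚᵘ (ℤ.+ ℤ.∣ ℚ.↥ q ∣) 0
      bound (ℚ.mkℚ (ℤ.+ n) e _) = ℚᵘ.*≤* (subst₂ ℤ._≤_ (sym (ℤ.*-identityʳ (ℤ.+ n))) (ℤ.pos-* n (suc e))
        (ℤ.+≤+ (ℕ.m≤m*n n (suc e))))
      bound (ℚ.mkℚ ℤ.-[1+ n ] e _) = ℚᵘ.*≤* ℤ.-≤+

  ι-mono : ∀ {m n} → m ℕ.≤ n → ι m ≤ ι n
  ι-mono {m} {n} m≤n = ≤-by (ι (n ℕ.∸ m)) (0≤ι (n ℕ.∸ m))
    (trans (sym (ι-+ m (n ℕ.∸ m))) (cong ι (ℕ.m+[n∸m]≡n m≤n)))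

  ι-∏ : (f : Fin n → ℕ) → ι (∏ f) ≡ ∏ℚ (ι ∘ f)
  ι-∏ {zero}  f = ι-1
  ι-∏ {suc n} f = trans (ι-* (f zero) _) (cong (ι (f zero) *_) (ι-∏ (f ∘ suc)))

  *-monoʳ : ∀ {p q} r → 0ℚ ≤ r → p ≤ q → r * p ≤ r * q
  *-monoʳ r 0≤r = ℚ.*-monoˡ-≤-nonNeg r {{ℚ.nonNegative 0≤r}}

  *-monoˡ : ∀ {p q} r → 0ℚ ≤ r → p ≤ q → p * r ≤ q * r
  *-monoˡ r 0≤r = ℚ.*-monoʳ-≤-nonNeg r {{ℚ.nonNegative 0≤r}}

  0≤∏ℚ : {f : Fin n → ℚ} → (∀ i → 0ℚ ≤ f i) → 0ℚ ≤ ∏ℚ f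
  0≤∏ℚ {zero}  0≤f = ℚ.<⇒≤ 0<1
  0≤∏ℚ {suc n} 0≤f = 0≤* (0≤f zero) (0≤∏ℚ (0≤f ∘ suc))

  ∏ℚ-mono : {f g : Fin n → ℚ} → (∀ i → 0ℚ ≤ f i) → (∀ i → f i ≤ g i) → ∏ℚ f ≤ ∏ℚ g
  ∏ℚ-mono {zero}  0≤f f≤g = ℚ.≤-refl
  ∏ℚ-mono {suc n} 0≤f f≤g = *-mono (0≤f zero) (f≤g zero) (0≤∏ℚ (0≤f ∘ suc)) (∏ℚ-mono (0≤f ∘ suc) (f≤g ∘ suc))

  -- The error `w` is charged once per entry. The list will be that of the representatives, whose
  -- length does not depend on the host tree.
  sum-bound : ∀ a b w (f g : X → ℕ) → (∀ x → a * ι (f x) ≤ b * ι (g x) + w) → ∀ xs →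
              a * ι (sum (List.map f xs)) ≤ b * ι (sum (List.map g xs)) + ι (length xs) * w
  sum-bound a b w f g f≤g [] = ℚ.≤-reflexive (trans (zero-* a)
    (sym (trans (cong₂ _+_ (zero-* b) (trans (cong (_* w) ι-0) (ℚ.*-zeroˡ w))) (ℚ.+-identityˡ 0ℚ))))
    where
    zero-* : ∀ a → a * ι 0 ≡ 0ℚ
    zero-* a = trans (cong (a *_) ι-0) (ℚ.*-zeroʳ a)
  sum-bound a b w f g f≤g (x ∷ xs) = begin
    a * ι (f x ℕ.+ s)                               ≡⟨ trans (cong (a *_) (ι-+ (f x) s)) (ℚ.*-distribˡ-+ a (ι (f x)) (ι s)) ⟩
    a * ι (f x) + a * ι s                           ≤⟨ ℚ.+-mono-≤ (f≤g x) (sum-bound a b w f g f≤g xs) ⟩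
    (b * ι (g x) + w) + (b * ι t + ι l * w)         ≡⟨ solve 5 (λ b u v w l → (b :* u :+ w) :+ (b :* v :+ l :* w) :=
                                                         b :* (u :+ v) :+ (w :+ l :* w)) refl b (ι (g x)) (ι t) w (ι l) ⟩
    b * (ι (g x) + ι t) + (w + ι l * w)             ≡⟨ cong₂ (λ u v → b * u + v) (ι-+ (g x) t) count ⟨
    b * ι (g x ℕ.+ t) + ι (suc l) * w               ∎
    where
    open ℚ.≤-Reasoning
    s = sum (List.map f xs)
    t = sum (List.map g xs)
    l = length xs
    count : ι (suc l) * w ≡ w + ι l * w
    count = trans (cong (_* w) (trans (ι-+ 1 l) (cong (_+ ι l) ι-1)))
      (trans (ℚ.*-distribʳ-+ w 1ℚ (ι l)) (cong (_+ ι l * w) (ℚ.*-identityˡ w)))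

  ∑-bound₂ : ∀ a b c (f g h : Fin n → ℕ) → (∀ i → a * ι (f i) ≤ b * ι (g i) + c * ι (h i)) →
             a * ι (∑ f) ≤ b * ι (∑ g) + c * ι (∑ h)
  ∑-bound₂ {zero} a b c f g h f≤ = ℚ.≤-reflexive (trans (zero-* a)
    (sym (trans (cong₂ _+_ (zero-* b) (zero-* c)) (ℚ.+-identityˡ 0ℚ))))
    where
    zero-* : ∀ a → a * ι 0 ≡ 0ℚ
    zero-* a = trans (cong (a *_) ι-0) (ℚ.*-zeroʳ a)
  ∑-bound₂ {suc n} a b c f g h f≤ = begin
    a * ι (f zero ℕ.+ ∑ (f ∘ suc))                  ≡⟨ trans (cong (a *_) (ι-+ (f zero) (∑ (f ∘ suc)))) (ℚ.*-distribˡ-+ a (ι (f zero)) (ι (∑ (f ∘ suc)))) ⟩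
    a * ι (f zero) + a * ι (∑ (f ∘ suc))            ≤⟨ ℚ.+-mono-≤ (f≤ zero) (∑-bound₂ a b c (f ∘ suc) (g ∘ suc) (h ∘ suc) (f≤ ∘ suc)) ⟩
    (b * ι (g zero) + c * ι (h zero)) + (b * ι (∑ (g ∘ suc)) + c * ι (∑ (h ∘ suc)))
      ≡⟨ solve 6 (λ b c u v u′ v′ → (b :* u :+ c :* v) :+ (b :* u′ :+ c :* v′) := b :* (u :+ u′) :+ c :* (v :+ v′))
           refl b c (ι (g zero)) (ι (h zero)) (ι (∑ (g ∘ suc))) (ι (∑ (h ∘ suc))) ⟩
    b * (ι (g zero) + ι (∑ (g ∘ suc))) + c * (ι (h zero) + ι (∑ (h ∘ suc)))
      ≡⟨ cong₂ (λ u v → b * u + c * v) (ι-+ (g zero) (∑ (g ∘ suc))) (ι-+ (h zero) (∑ (h ∘ suc))) ⟨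
    b * ι (∑ g) + c * ι (∑ h) ∎
    where open ℚ.≤-Reasoning

  -- Induction over the host tree.

  module Bound
    {d K : ℕ} (D : Tree d) (2≤‖D‖ : 2 ℕ.≤ ‖ D ‖) (‖D‖≡ : ‖ D ‖ ≡ suc (suc K)) (M : Representatives D)
    (c : Fin d → ℚ) (0≤c : ∀ i → 0ℚ ≤ c i) (N : ℕ)
    (branch≤ : ∀ i T → ‖ branches D i ‖ ℕ.≤ 1 ⊎ N ℕ.< ‖ T ‖ →
               ι (‖ branches D i ‖ !) * ι (copies (branches D i) T) ≤ c i * ι (‖ T ‖ ℕ.^ ‖ branches D i ‖))
    (r : ℚ) (0≤r : 0ℚ ≤ r)
    -- The inequality Z_D(m / ∑ m) ≤ r, multiplied by its denominator and by the power of ∑ m that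
    -- clears all fractions.
    (Z≤ : ∀ (m : Fin d → ℕ) → (∀ j → m j ℕ.< ∑ m) →
          ι (sum (List.map (λ π → ∏ (λ j → m j ℕ.^ ‖ branches D (π ⟨$⟩ʳ j) ‖)) (Representatives.list M))) ≤
          r * (ι (∑ m ℕ.^ ‖ D ‖) - ι (∑ (λ j → m j ℕ.^ ‖ D ‖))))
    where

    -- F clears the factorials.  The term E n ^ k absorbs the placements in which a
    -- branch with at most N leaves hosts a branch of D with at least two leaves.
    k L F E : ℕ
    k = suc K
    L = length (Representatives.list M)
    F = ∏ (λ i → ‖ branches D i ‖ !)
    E = L ℕ.* (F ℕ.* N) ℕ.+ F

    C : ℚ
    C = ∏ℚ c

    0≤C : 0ℚ ≤ C
    0≤C = 0≤∏ℚ 0≤c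

    exponent : Permutation′ d → Fin d → ℕ
    exponent π j = ‖ branches D (π ⟨$⟩ʳ j) ‖

    ∑-exponent : ∀ π → ∑ (exponent π) ≡ suc k
    ∑-exponent π = trans (sym (∑-permute (λ i → ‖ branches D i ‖) π)) (trans (∑-‖branches‖ D 2≤‖D‖) ‖D‖≡)

    module _ (ts : List (NonemptyTree d)) (ts≤d : length ts ℕ.≤ d) where

      m : Fin d → ℕ
      m j = ‖ pad {d} ts j ‖

      -- The amount by which the sum of the k-th powers grows on passing from the branches to the
      -- whole tree; `E` times it is the budget for the errors at this node.
      gap : ℚ
      gap = ι (∑ m ℕ.^ k) - ι (∑ (λ j → m j ℕ.^ k))

      0≤gap : 0ℚ ≤ gap
      0≤gap = 0≤q-p (ι-mono (∑^≤^∑ K m))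

      monomial : Permutation′ d → ℕ
      monomial π = ∏ (λ j → m j ℕ.^ exponent π j)

      -- `F` and `C` are invariant under reindexing by `π`, which hands each factor the factorial
      -- and the constant of the branch of `D` placed there.
      large-branches : ∀ π → (∀ j → exponent π j ℕ.≤ 1 ⊎ N ℕ.< m j) →
                       ι F * ι (branch-product D ts π) ≤ C * ι (monomial π)
      large-branches π large = begin
        ι F * ι (branch-product D ts π)
          ≡⟨ cong (λ v → ι v * ι (branch-product D ts π)) (∏-permute (λ i → ‖ branches D i ‖ !) π) ⟩
        ι (∏ (λ j → exponent π j !)) * ι (branch-product D ts π)
          ≡⟨ cong₂ _*_ (ι-∏ (λ j → exponent π j !)) (ι-∏ (λ j → copies (branches D (π ⟨$⟩ʳ j)) (pad {d} ts j))) ⟩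
        ∏ℚ (λ j → ι (exponent π j !)) * ∏ℚ (λ j → ι (copies (branches D (π ⟨$⟩ʳ j)) (pad {d} ts j)))
          ≡⟨ ∏ℚ-distrib-* (λ j → ι (exponent π j !)) (λ j → ι (copies (branches D (π ⟨$⟩ʳ j)) (pad {d} ts j))) ⟨
        ∏ℚ (λ j → ι (exponent π j !) * ι (copies (branches D (π ⟨$⟩ʳ j)) (pad {d} ts j)))
          ≤⟨ ∏ℚ-mono (λ j → 0≤* (0≤ι _) (0≤ι _)) (λ j → branch≤ (π ⟨$⟩ʳ j) (pad {d} ts j) (large j)) ⟩
        ∏ℚ (λ j → c (π ⟨$⟩ʳ j) * ι (m j ℕ.^ exponent π j))
          ≡⟨ ∏ℚ-distrib-* (λ j → c (π ⟨$⟩ʳ j)) (λ j → ι (m j ℕ.^ exponent π j)) ⟩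
        ∏ℚ (λ j → c (π ⟨$⟩ʳ j)) * ∏ℚ (λ j → ι (m j ℕ.^ exponent π j))
          ≡⟨ cong₂ _*_ (∏ℚ-permute c π) (ι-∏ (λ j → m j ℕ.^ exponent π j)) ⟨
        C * ι (monomial π) ∎
        where open ℚ.≤-Reasoning

      -- All factors get the trivial bound `copies≤^`; the small `m j` then lowers the degree by one
      -- at the price of `N`.
      some-small-branch : ∀ π j → 2 ℕ.≤ exponent π j → m j ℕ.≤ N →
                          ι F * ι (branch-product D ts π) ≤ ι (F ℕ.* N) * gap
      some-small-branch π j 2≤e mj≤N = begin
        ι F * ι (branch-product D ts π)
          ≤⟨ *-monoʳ (ι F) (0≤ι F) (ι-mono (∏-mono λ i → copies≤^ (branches D (π ⟨$⟩ʳ i)) (pad {d} ts i))) ⟩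
        ι F * ι (monomial π)
          ≤⟨ *-monoʳ (ι F) (0≤ι F) (≤-by (ι N * ι (∑ m ℕ.^ k) - (ι (monomial π) + ι N * ι s)) (0≤q-p mixed)
               (solve 4 (λ u n v w → u :+ (n :* v :- (u :+ n :* w)) := n :* (v :- w)) refl (ι (monomial π)) (ι N) (ι (∑ m ℕ.^ k)) (ι s))) ⟩
        ι F * (ι N * gap)
          ≡⟨ trans (cong (_* gap) (ι-* F N)) (ℚ.*-assoc (ι F) (ι N) gap) ⟨
        ι (F ℕ.* N) * gap ∎
        where
        open ℚ.≤-Reasoning
        s = ∑ (λ j → m j ℕ.^ k)
        mixed : ι (monomial π) + ι N * ι s ≤ ι N * ι (∑ m ℕ.^ k)
        mixed = subst₂ _≤_ (trans (ι-+ (monomial π) _) (cong (ι (monomial π) +_) (ι-* N s))) (ι-* N _)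
          (ι-mono (small-branch m (exponent π) j 2≤e
            (subst (exponent π j ℕ.<_) ‖D‖≡ (‖branches‖< D 2≤‖D‖ (π ⟨$⟩ʳ j))) (∑-exponent π) mj≤N))

      -- Whichever case applies, the bound belonging to the other one is nonnegative, so the sum
      -- covers both.
      branch-product≤ : ∀ π → ι F * ι (branch-product D ts π) ≤ C * ι (monomial π) + ι (F ℕ.* N) * gap
      branch-product≤ π with Fin.any? (λ j → (2 ℕ.≤? exponent π j) ×-dec (m j ℕ.≤? N))
      ... | yes (j , 2≤e , mj≤N) = ≤-by (C * ι (monomial π) + (ι (F ℕ.* N) * gap - ι F * ι (branch-product D ts π)))
        (0≤+ (0≤* 0≤C (0≤ι (monomial π))) (0≤q-p (some-small-branch π j 2≤e mj≤N)))
        (solve 3 (λ u v w → u :+ (v :+ (w :- u)) := v :+ w) refl (ι F * ι (branch-product D ts π)) (C * ι (monomial π)) (ι (F ℕ.* N) * gap))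
      ... | no ∄j = ℚ.≤-trans (large-branches π large)
        (≤-by (ι (F ℕ.* N) * gap) (0≤* (0≤ι (F ℕ.* N)) 0≤gap) refl)
        where
        large : ∀ j → exponent π j ℕ.≤ 1 ⊎ N ℕ.< m j
        large j with 2 ℕ.≤? exponent π j
        ... | no  2≰e = inj₁ (ℕ.≤-pred (ℕ.≰⇒> 2≰e))
        ... | yes 2≤e = inj₂ (ℕ.≰⇒> (λ mj≤N → ∄j (j , 2≤e , mj≤N)))

    A : ℚ
    A = C * r

    0≤A : 0ℚ ≤ A
    0≤A = 0≤* 0≤C 0≤r

    Bounded : Tree d → Set
    Bounded T = ι F * ι (copies D T) ≤ A * ι (‖ T ‖ ℕ.^ suc k) + ι E * ι (‖ T ‖ ℕ.^ k)

    Bounded-empty : Bounded nothing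
    Bounded-empty = ≤-by (A * ι 0 + ι E * ι 0) (0≤+ (0≤* 0≤A (0≤ι 0)) (0≤* (0≤ι E) (0≤ι 0)))
      (trans (cong (_+ (A * ι 0 + ι E * ι 0)) (trans (cong (λ v → ι F * ι v) none) (trans (cong (ι F *_) ι-0) (ℚ.*-zeroʳ (ι F)))))
        (ℚ.+-identityˡ _))
      where
      none : copies D nothing ≡ 0
      none = ℕ.n≤0⇒n≡0 (subst (λ v → copies D nothing ℕ.≤ 0 ℕ.^ v) ‖D‖≡ (copies≤^ D nothing))

    -- The second summand `F` of `E` exists for this case: a single leaf contains at most one copy.
    Bounded-leaf : Bounded (just leaf)
    Bounded-leaf = begin
      ι F * ι (copies D (just leaf))     ≤⟨ *-monoʳ (ι F) (0≤ι F) (ι-mono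
                                              (subst (copies D (just leaf) ℕ.≤_) (ℕ.^-zeroˡ ‖ D ‖) (copies≤^ D (just leaf)))) ⟩
      ι F * ι 1                          ≤⟨ *-monoˡ (ι 1) (0≤ι 1) (ι-mono (ℕ.m≤n+m F (L ℕ.* (F ℕ.* N)))) ⟩
      ι E * ι 1                          ≤⟨ ≤-by (A * ι (1 ℕ.^ suc k)) (0≤* 0≤A (0≤ι _))
                                              (trans (ℚ.+-comm (ι E * ι 1) (A * ι (1 ℕ.^ suc k))) (cong (λ v → A * ι (1 ℕ.^ suc k) + ι E * ι v) (sym (ℕ.^-zeroˡ k)))) ⟩
      A * ι (1 ℕ.^ suc k) + ι E * ι (1 ℕ.^ k) ∎
      where open ℚ.≤-Reasoning

    Bounded-node : ∀ ts p ts≤d → (∀ (j : Fin d) → Bounded (pad {d} ts j)) → Bounded (just (node ts p ts≤d))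
    Bounded-node ts p ts≤d ih = begin
      ι F * ι (copies D (just (node ts p ts≤d)))
        ≤⟨ *-monoʳ (ι F) (0≤ι F) (ι-mono (copies-node D 2≤‖D‖ M ts p ts≤d)) ⟩
      ι F * ι (∑ {d} (λ j → copies D (pad {d} ts j)) ℕ.+ s)
        ≡⟨ trans (cong (ι F *_) (ι-+ (∑ {d} (λ j → copies D (pad {d} ts j))) s)) (ℚ.*-distribˡ-+ (ι F) _ (ι s)) ⟩
      ι F * ι (∑ {d} (λ j → copies D (pad {d} ts j))) + ι F * ι s
        ≤⟨ ℚ.+-mono-≤ (∑-bound₂ (ι F) A (ι E) (λ j → copies D (pad {d} ts j)) (λ j → μ j ℕ.^ suc k) (λ j → μ j ℕ.^ k) ih)
             (sum-bound (ι F) C (ι (F ℕ.* N) * (V - v)) (branch-product D ts) (monomial ts ts≤d) (branch-product≤ ts ts≤d) list) ⟩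
      (A * u + ι E * v) + (C * ι t + ι L * (ι (F ℕ.* N) * (V - v)))
        -- `Z≤` turns the monomials into the increment U - u, and the `L` error terms are paid for
        -- by the first summand of `E`. Adding the induction hypotheses then cancels u and v.
        ≤⟨ ℚ.+-monoʳ-≤ (A * u + ι E * v) (ℚ.+-mono-≤ (*-monoʳ C 0≤C Zn) (*-extra)) ⟩
      (A * u + ι E * v) + (C * (r * (U - u)) + ι E * (V - v))
        ≡⟨ solve 7 (λ C r e u v U V → (C :* r :* u :+ e :* v) :+ (C :* (r :* (U :- u)) :+ e :* (V :- v)) := C :* r :* U :+ e :* V)
             refl C r (ι E) u v U V ⟩
      A * U + ι E * V
        ≡⟨ cong (λ l → A * ι (l ℕ.^ suc k) + ι E * ι (l ℕ.^ k)) (∑-‖pad‖ {d = d} {n = d} ts ts≤d) ⟩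
      A * ι (leaves* ts ℕ.^ suc k) + ι E * ι (leaves* ts ℕ.^ k) ∎
      where
      open ℚ.≤-Reasoning
      list = Representatives.list M
      μ : Fin d → ℕ
      μ = m ts ts≤d
      s t : ℕ
      s = sum (List.map (branch-product D ts) list)
      t = sum (List.map (monomial ts ts≤d) list)
      u v U V : ℚ
      u = ι (∑ (λ j → μ j ℕ.^ suc k))
      v = ι (∑ (λ j → μ j ℕ.^ k))
      U = ι (∑ μ ℕ.^ suc k)
      V = ι (∑ μ ℕ.^ k)
      Zn : ι t ≤ r * (U - u)
      Zn = subst (λ q → ι t ≤ r * (ι (∑ μ ℕ.^ q) - ι (∑ (λ j → μ j ℕ.^ q)))) ‖D‖≡
        (Z≤ μ λ j → subst (μ j ℕ.<_) (sym (∑-‖pad‖ {d = d} {n = d} ts ts≤d)) (‖pad‖< ts p j))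
      *-extra : ι L * (ι (F ℕ.* N) * (V - v)) ≤ ι E * (V - v)
      *-extra = ℚ.≤-trans (ℚ.≤-reflexive (trans (sym (ℚ.*-assoc (ι L) (ι (F ℕ.* N)) (V - v))) (cong (_* (V - v)) (sym (ι-* L (F ℕ.* N))))))
        (*-monoˡ (V - v) (0≤gap ts ts≤d) (ι-mono (ℕ.m≤m+n (L ℕ.* (F ℕ.* N)) F)))

    -- `bounded*` descends the list of children itself, which keeps the recursion through `pad`
    -- structural.
    bounded⁺ : ∀ t → Bounded (just t)
    bounded* : ∀ ts {n} (j : Fin n) → Bounded (pad {d} ts j)
    bounded⁺ leaf             = Bounded-leaf
    bounded⁺ (node ts p ts≤d) = Bounded-node ts p ts≤d (bounded* ts)
    bounded* []       j       = Bounded-empty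
    bounded* (t ∷ ts) zero    = bounded⁺ t
    bounded* (t ∷ ts) (suc j) = bounded* ts j

    copies-bound : ∀ T → Bounded T
    copies-bound (just t) = bounded⁺ t
    copies-bound nothing  = Bounded-empty

-- Evaluating Z_D at rational points, and passing between cuts and densities.

module Limit where

  open import Algebra.Bundles using (CommutativeRing)

  open import Data.Fin.Base using (Fin; zero; suc)
  open import Data.Fin.Permutation using (Permutation′; _⟨$⟩ʳ_)
  open import Data.List.Base as List using ([]; _∷_)
  open import Data.Maybe.Base using (just; nothing)
  open import Data.Nat.Base as ℕ using (ℕ; zero; suc; z≤n; s≤s; _!)
  open import Data.Nat.Combinatorics using (_C_; nC1≡n)
  open import Data.Nat.Combinatorics.Base using (_P′_)
  open import Data.Nat.ListAction using (sum)
  import Data.Nat.Properties as ℕ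
  open import Data.Product.Base using (∃; _×_; _,_; proj₁; proj₂)
  open import Data.Rational.Base as ℚ using (ℚ; 0ℚ; 1ℚ; _+_; _*_; -_; _-_; _≤_; _<_)
  import Data.Rational.Properties as ℚ
  open import Data.Rational.Solver using (module +-*-Solver)
  import Data.Sum.Base as Sum
  open import Data.Sum.Base using (_⊎_; inj₁; inj₂)
  open import Function.Base using (_∘_)
  open import Relation.Binary.PropositionalEquality
  open import Relation.Nullary using (contradiction)
  open import Algebra.Properties.Semiring.Exp (CommutativeRing.semiring ℚ.+-*-commutativeRing) using (_^_; ^-homo-*)
  open +-*-Solver using (solve; _:=_; _:+_; _:*_; _:-_; :-_)
  open [0,∞] using (cut)
  open Counting
  open Estimates
  open Rationals
  private
    variable
      d n : ℕ
      X : Set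

  *-interchange : ∀ p q r s → (p * q) * (r * s) ≡ (p * r) * (q * s)
  *-interchange = solve 4 (λ p q r s → (p :* q) :* (r :* s) := (p :* r) :* (q :* s)) refl

  *-cancelʳ-≤ : ∀ {p q r} → 0ℚ < r → p * r ≤ q * r → p ≤ q
  *-cancelʳ-≤ {r = r} 0<r = ℚ.*-cancelʳ-≤-pos r {{ℚ.positive 0<r}}

  0≤^ : ∀ {x} k → 0ℚ ≤ x → 0ℚ ≤ x ^ k
  0≤^ zero    0≤x = ℚ.<⇒≤ 0<1
  0≤^ (suc k) 0≤x = 0≤* 0≤x (0≤^ k 0≤x)

  ι-^ : ∀ m k → ι m ^ k ≡ ι (m ℕ.^ k)
  ι-^ m zero    = sym ι-1
  ι-^ m (suc k) = trans (cong (ι m *_) (ι-^ m k)) (sym (ι-* m (m ℕ.^ k)))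

  -- The x j are the fractions m j / t; a power of t clears the denominators.
  module Homogeneous {t : ℚ} (N : ℕ) where

    scaled-^ : ∀ {x m} → seq x N * t ≡ ι m → ∀ k → seq (x ^ᴿ k) N * t ^ k ≡ ι (m ℕ.^ k)
    scaled-^ x≡ zero    = trans (ℚ.*-identityˡ 1ℚ) (sym ι-1)
    scaled-^ {x} {m} x≡ (suc k) = trans (*-interchange (seq x N) (seq (x ^ᴿ k) N) t (t ^ k))
      (trans (cong₂ _*_ x≡ (scaled-^ x≡ k)) (sym (ι-* m (m ℕ.^ k))))

    scaled-∑ : ∀ {s} {x : Fin n → ℝ} {m} → (∀ j → seq (x j) N * s ≡ ι (m j)) → seq (∑ᴿ x) N * s ≡ ι (∑ m)
    scaled-∑ {zero}  {s} x≡ = trans (ℚ.*-zeroˡ s) (sym ι-0)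
    scaled-∑ {suc n} {s} {x} {m} x≡ = trans (ℚ.*-distribʳ-+ s (seq (x zero) N) (seq (∑ᴿ (x ∘ suc)) N))
      (trans (cong₂ _+_ (x≡ zero) (scaled-∑ (x≡ ∘ suc))) (sym (ι-+ (m zero) (∑ (m ∘ suc)))))

    scaled-∏ : {x : Fin n → ℝ} {m : Fin n → ℕ} → (∀ j → seq (x j) N * t ≡ ι (m j)) → (e : Fin n → ℕ) →
               seq (∏ᴿ (λ j → x j ^ᴿ e j)) N * t ^ ∑ e ≡ ι (∏ (λ j → m j ℕ.^ e j))
    scaled-∏ {zero}  x≡ e = trans (ℚ.*-identityˡ 1ℚ) (sym ι-1)
    scaled-∏ {suc n} {x} {m} x≡ e = begin
      (seq (x zero ^ᴿ e zero) N * p) * t ^ (e zero ℕ.+ ∑ (e ∘ suc))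
        ≡⟨ cong ((seq (x zero ^ᴿ e zero) N * p) *_) (^-homo-* t (e zero) (∑ (e ∘ suc))) ⟩
      (seq (x zero ^ᴿ e zero) N * p) * (t ^ e zero * t ^ ∑ (e ∘ suc))
        ≡⟨ *-interchange (seq (x zero ^ᴿ e zero) N) p (t ^ e zero) (t ^ ∑ (e ∘ suc)) ⟩
      (seq (x zero ^ᴿ e zero) N * t ^ e zero) * (p * t ^ ∑ (e ∘ suc))
        ≡⟨ cong₂ _*_ (scaled-^ {x zero} (x≡ zero) (e zero)) (scaled-∏ (x≡ ∘ suc) (e ∘ suc)) ⟩
      ι (m zero ℕ.^ e zero) * ι (∏ (λ j → m (suc j) ℕ.^ e (suc j)))
        ≡⟨ ι-* (m zero ℕ.^ e zero) _ ⟨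
      ι (∏ (λ j → m j ℕ.^ e j)) ∎
      where
      open ≡-Reasoning
      p = seq (∏ᴿ (λ j → x (suc j) ^ᴿ e (suc j))) N

    scaled-sum : ∀ {s} (f : X → ℝ) (h : X → ℕ) → (∀ a → seq (f a) N * s ≡ ι (h a)) → ∀ as →
                 seq (List.foldr _+ᴿ_ 0ᴿ (List.map f as)) N * s ≡ ι (sum (List.map h as))
    scaled-sum {s = s} f h f≡ []       = trans (ℚ.*-zeroˡ s) (sym ι-0)
    scaled-sum {s = s} f h f≡ (a ∷ as) = trans (ℚ.*-distribʳ-+ s (seq (f a) N) _)
      (trans (cong₂ _+_ (f≡ a) (scaled-sum f h f≡ as)) (sym (ι-+ (h a) _)))

  module _ (m : Fin d → ℕ) (m<∑m : ∀ j → m j ℕ.< ∑ m) (0<∑m : 0 ℕ.< ∑ m) where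

    private
      t t⁻¹ : ℚ
      t   = ι (∑ m)
      t⁻¹ = recip t

      0<t : 0ℚ < t
      0<t = 0<ι (∑ m) 0<∑m

      t⁻¹t≡1 : t⁻¹ * t ≡ 1ℚ
      t⁻¹t≡1 = recip-inverse 0<t

      coordinate : Fin d → ℝ
      coordinate j = fromℚ (ι (m j) * t⁻¹)

      scaled-coordinate : ∀ j → ι (m j) * t⁻¹ * t ≡ ι (m j)
      scaled-coordinate j = trans (ℚ.*-assoc (ι (m j)) t⁻¹ t) (trans (cong (ι (m j) *_) t⁻¹t≡1) (ℚ.*-identityʳ (ι (m j))))

      coordinate<1 : ∀ j → ι (m j) * t⁻¹ < 1ℚ
      coordinate<1 j = subst (ι (m j) * t⁻¹ <_) (trans (ℚ.*-comm t t⁻¹) t⁻¹t≡1)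
        (ℚ.*-monoˡ-<-pos t⁻¹ {{ℚ.positive (recip-pos 0<t)}} {ι (m j)} {t} m<t)
        where
        m<t : ι (m j) < t
        m<t = ℚ.<-≤-trans (<-by 1ℚ 0<1 (trans (ℚ.+-comm (ι (m j)) 1ℚ)
          (trans (cong (_+ ι (m j)) (sym ι-1)) (sym (ι-+ 1 (m j)))))) (ι-mono (m<∑m j))

      ∑-coordinate : ∀ N → seq (∑ᴿ coordinate) N ≡ 1ℚ
      ∑-coordinate N = begin
        seq (∑ᴿ coordinate) N               ≡⟨ ℚ.*-identityʳ _ ⟨
        seq (∑ᴿ coordinate) N * 1ℚ          ≡⟨ cong (seq (∑ᴿ coordinate) N *_) (trans (ℚ.*-comm t t⁻¹) t⁻¹t≡1) ⟨
        seq (∑ᴿ coordinate) N * (t * t⁻¹)   ≡⟨ ℚ.*-assoc (seq (∑ᴿ coordinate) N) t t⁻¹ ⟨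
        seq (∑ᴿ coordinate) N * t * t⁻¹     ≡⟨ cong (_* t⁻¹) (Homogeneous.scaled-∑ {t} N {x = coordinate} {m = m} scaled-coordinate) ⟩
        t * t⁻¹                             ≡⟨ trans (ℚ.*-comm t t⁻¹) t⁻¹t≡1 ⟩
        1ℚ                                  ∎
        where open ≡-Reasoning

    -- The coordinates are constant sequences, so each condition on reals is a rational inequality
    -- valid from index 0 on. `m<∑m` keeps every coordinate below 1.
    proportions : Simplex d
    proportions = record
      { coord = coordinate
      ; 0≤    = λ j {ε} 0<ε → 0 , λ _ _ → 0≤+ (0≤* (0≤ι (m j)) (ℚ.<⇒≤ (recip-pos 0<t))) (ℚ.<⇒≤ 0<ε)
      ; <1    = λ j → 1ℚ - ι (m j) * t⁻¹ , 0<q-p (coordinate<1 j) , 0 , λ _ _ → ℚ.≤-reflexive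
                  (solve 2 (λ x u → x :+ (u :- x) := u) refl (ι (m j) * t⁻¹) 1ℚ)
      ; sum≈1 = (λ {ε} 0<ε → 0 , λ N _ → ≤-by ε (ℚ.<⇒≤ 0<ε) (cong (_+ ε) (∑-coordinate N)))
              , (λ {ε} 0<ε → 0 , λ N _ → ≤-by ε (ℚ.<⇒≤ 0<ε) (cong (_+ ε) (sym (∑-coordinate N))))
      }

    -- At one index beyond both moduli Z_D is a rational quotient with positive denominator. Every
    -- monomial has total degree ‖D‖, so multiplication by (∑ m)^‖D‖ clears the fractions.
    Z-proportions : ∀ (D : Tree d) (2≤‖D‖ : 2 ℕ.≤ ‖ D ‖) (M : Representatives D) {r} →
                    Z D 2≤‖D‖ M proportions <ᴿ fromℚ r →
                    ι (sum (List.map (λ π → ∏ (λ j → m j ℕ.^ ‖ branches D (π ⟨$⟩ʳ j) ‖)) (Representatives.list M))) ≤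
                    r * (ι (∑ m ℕ.^ ‖ D ‖) - ι (∑ (λ j → m j ℕ.^ ‖ D ‖)))
    Z-proportions D 2≤‖D‖ M {r} (δ , 0<δ , N₁ , Z+δ≤r)
      with δ′ , 0<δ′ , N₂ , δ′≤den ← denominator-pos 2≤‖D‖ proportions = begin
      ι (sum (List.map (λ π → ∏ (λ j → m j ℕ.^ ‖ branches D (π ⟨$⟩ʳ j) ‖)) list))
        ≡⟨ scaled-sum (λ π → ∏ᴿ λ j → coordinate j ^ᴿ ‖ branches D (π ⟨$⟩ʳ j) ‖) monomial (λ π →
             subst (λ e → seq (∏ᴿ λ j → coordinate j ^ᴿ ‖ branches D (π ⟨$⟩ʳ j) ‖) N * t ^ e ≡ ι (monomial π))
               (trans (sym (∑-permute (λ i → ‖ branches D i ‖) π)) (∑-‖branches‖ D 2≤‖D‖))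
               (scaled-∏ {x = coordinate} {m = m} scaled-coordinate (λ j → ‖ branches D (π ⟨$⟩ʳ j) ‖))) list ⟨
      num * t ^ ‖ D ‖
        ≤⟨ *-monoˡ (t ^ ‖ D ‖) (0≤^ (‖ D ‖) (ℚ.<⇒≤ 0<t)) num≤ ⟩
      r * den * t ^ ‖ D ‖
        ≡⟨ trans (ℚ.*-assoc r den (t ^ ‖ D ‖)) (cong (r *_) (expand (seq (∑ᴿ (λ j → coordinate j ^ᴿ ‖ D ‖)) N) (t ^ ‖ D ‖))) ⟩
      r * (t ^ ‖ D ‖ - seq (∑ᴿ (λ j → coordinate j ^ᴿ ‖ D ‖)) N * t ^ ‖ D ‖)
        ≡⟨ cong₂ (λ u v → r * (u - v)) (ι-^ (∑ m) (‖ D ‖))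
             (scaled-∑ {x = λ j → coordinate j ^ᴿ ‖ D ‖} {m = λ j → m j ℕ.^ ‖ D ‖}
               (λ j → scaled-^ {coordinate j} (scaled-coordinate j) (‖ D ‖))) ⟩
      r * (ι (∑ m ℕ.^ ‖ D ‖) - ι (∑ (λ j → m j ℕ.^ ‖ D ‖))) ∎
      where
      open ℚ.≤-Reasoning
      N = N₁ ℕ.⊔ N₂
      open Homogeneous {t} N
      list = Representatives.list M
      monomial : Permutation′ d → ℕ
      monomial π = ∏ (λ j → m j ℕ.^ ‖ branches D (π ⟨$⟩ʳ j) ‖)
      den num : ℚ
      den = seq (denominator ‖ D ‖ proportions) N
      num = seq (List.foldr _+ᴿ_ 0ᴿ (List.map (λ π → ∏ᴿ λ j → coordinate j ^ᴿ ‖ branches D (π ⟨$⟩ʳ j) ‖) list)) N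
      expand : ∀ s u → (1ℚ - s) * u ≡ u - s * u
      expand s u = trans (solve 3 (λ o s u → (o :- s) :* u := o :* u :- s :* u) refl 1ℚ s u)
        (cong (_- s * u) (ℚ.*-identityˡ u))
      0<den : 0ℚ < den
      0<den = ℚ.<-≤-trans 0<δ′ (subst (_≤ den) (ℚ.+-identityˡ δ′) (δ′≤den N (ℕ.m≤n⊔m N₁ N₂)))
      num≤ : num ≤ r * den
      num≤ = begin
        num                        ≡⟨ ℚ.*-identityˡ num ⟨
        1ℚ * num                   ≡⟨ cong (_* num) (recip-inverse 0<den) ⟨
        recip den * den * num      ≡⟨ solve 3 (λ a b c → a :* b :* c := a :* c :* b) refl (recip den) den num ⟩
        recip den * num * den      ≤⟨ *-monoˡ den (ℚ.<⇒≤ 0<den)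
                                        (ℚ.≤-trans (≤-by {recip den * num} δ (ℚ.<⇒≤ 0<δ) refl) (Z+δ≤r N (ℕ.m≤m⊔n N₁ N₂))) ⟩
        r * den                    ∎

  copies≤density : ∀ (D T : Tree d) {q} → density D T ≤ q → ι (copies D T) ≤ q * ι ((‖ T ‖) C (‖ D ‖))
  copies≤density D T {q} ≤q with (‖ T ‖) C (‖ D ‖) | copies≤C D T
  -- With a vanishing binomial coefficient the density is 0 by convention, but then there are no
  -- copies either.
  ... | zero      | none = subst₂ _≤_ (cong ι (sym (ℕ.n≤0⇒n≡0 none))) (trans (sym (ℚ.*-zeroʳ q)) (cong (q *_) (sym ι-0)))
                             (ℚ.≤-reflexive ι-0)
  ... | b@(suc _) | _    = subst (_≤ q * ι b) (/-*-ι (copies D T) b) (*-monoˡ (ι b) (0≤ι b) ≤q)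

  density≤ : ∀ (D T : Tree d) {q} → 0ℚ ≤ q → ι (copies D T) ≤ q * ι ((‖ T ‖) C (‖ D ‖)) → density D T ≤ q
  density≤ D T 0≤q copies≤ with (‖ T ‖) C (‖ D ‖)
  ... | zero      = 0≤q
  ... | b@(suc _) = *-cancelʳ-≤ (0<ι b (s≤s z≤n)) (ℚ.≤-trans (ℚ.≤-reflexive (/-*-ι (copies D T) b)) copies≤)

  fromℚ<fromℚ⇒≤ : ∀ {p q} → fromℚ p <ᴿ fromℚ q → p ≤ q
  fromℚ<fromℚ⇒≤ (δ , 0<δ , N , p+δ≤q) = ℚ.≤-trans (≤-by δ (ℚ.<⇒≤ 0<δ) refl) (p+δ≤q N ℕ.≤-refl)

  <⇒cut-upperℚ : ∀ {p q} → 0ℚ < q → p < q → cut (upperℚ p) q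
  <⇒cut-upperℚ {p} {q} 0<q p<q = 0<q , q - p , 0<q-p p<q , 0 , λ _ _ →
    ℚ.≤-reflexive (solve 2 (λ p q → p :+ (q :- p) := q) refl p q)

  cut-inducibility⇒density≤ : ∀ (t : NonemptyTree d) {q} → cut (inducibility (just t)) q →
                              ∃ λ N → ∀ T → N ℕ.≤ ‖ T ‖ → density (just t) T ≤ q
  cut-inducibility⇒density≤ t (N , r , 0<r , r<q , bound) = N , λ T N≤T →
    let r′ , 0<r′ , r′<r , dens = bound (‖ T ‖ , N≤T)
    in ℚ.≤-trans (fromℚ<fromℚ⇒≤ (proj₂ (dens (T , refl)))) (ℚ.<⇒≤ (ℚ.<-trans r′<r r<q))

  density≤⇒cut-inducibility : ∀ (t : NonemptyTree d) {p q} → 0ℚ ≤ p → p < q → ∀ N →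
                              (∀ T → N ℕ.≤ ‖ T ‖ → density (just t) T ≤ p) → cut (inducibility (just t)) q
  density≤⇒cut-inducibility t 0≤p p<q N dens =
    -- Each of the two nested suprema, over sizes and over trees, has a cut that uses up one strict
    -- inequality.
    let r , p<r , r<q = ℚ.<-dense p<q
        s , p<s , s<r = ℚ.<-dense p<r
        0<s = ℚ.≤-<-trans 0≤p p<s
    in N , r , ℚ.<-trans 0<s s<r , r<q , λ (n , N≤n) → s , 0<s , s<r , λ (T , ‖T‖≡n) →
         <⇒cut-upperℚ 0<s (ℚ.≤-<-trans (dens T (subst (N ℕ.≤_) (sym ‖T‖≡n) N≤n)) p<s)

  -- Caterpillars provide trees with arbitrarily many leaves.
  1≤cut-inducibility-leaf : 2 ℕ.≤ d → ∀ {q} → cut (inducibility {d} (just leaf)) q → 1ℚ ≤ q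
  1≤cut-inducibility-leaf 2≤d {q} I<q with N , dens ← cut-inducibility⇒density≤ leaf I<q
    with t , eq ← caterpillar 2≤d N = *-cancelʳ-≤ (0<ι (suc N) (s≤s z≤n)) (begin
      1ℚ * ι (suc N)                  ≡⟨ trans (ℚ.*-identityˡ (ι (suc N))) (cong ι (sym eq)) ⟩
      ι (leaves t)                    ≤⟨ ι-mono (‖‖≤copies-leaf (just t)) ⟩
      ι (copies (just leaf) (just t)) ≤⟨ copies≤density (just leaf) (just t) (dens (just t) (subst (N ℕ.≤_) (sym eq) (ℕ.n≤1+n N))) ⟩
      q * ι (leaves t C 1)            ≡⟨ cong (λ v → q * ι v) (trans (nC1≡n (leaves t)) eq) ⟩
      q * ι (suc N)                   ∎)
    where open ℚ.≤-Reasoning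

  -- The factorial is 1 here, so `copies≤^` is already the claim with coefficient 1, for hosts of
  -- any size.
  copies-≤1 : ∀ (B T : Tree d) {q} → ‖ B ‖ ℕ.≤ 1 → 1ℚ ≤ q →
              ι (‖ B ‖ !) * ι (copies B T) ≤ q * ι (‖ T ‖ ℕ.^ ‖ B ‖)
  copies-≤1 B T {q} ‖B‖≤1 1≤q = begin
    ι (‖ B ‖ !) * ι (copies B T)     ≡⟨ cong (λ v → v * ι (copies B T)) (trans (cong ι (!≡1 ‖B‖≤1)) ι-1) ⟩
    1ℚ * ι (copies B T)              ≤⟨ *-mono (ℚ.<⇒≤ 0<1) 1≤q (0≤ι (copies B T)) (ι-mono (copies≤^ B T)) ⟩
    q * ι (‖ T ‖ ℕ.^ ‖ B ‖)          ∎
    where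
    open ℚ.≤-Reasoning
    !≡1 : ∀ {k} → k ℕ.≤ 1 → k ! ≡ 1
    !≡1 z≤n       = refl
    !≡1 (s≤s z≤n) = refl

  copies-large : ∀ {q N} (t : NonemptyTree d) → 0ℚ ≤ q → (∀ T → N ℕ.≤ ‖ T ‖ → density (just t) T ≤ q) →
                 ∀ T → N ℕ.≤ ‖ T ‖ → ι (leaves t !) * ι (copies (just t) T) ≤ q * ι (‖ T ‖ ℕ.^ leaves t)
  copies-large {q = q} t 0≤q dens T N≤T = begin
    ι (k !) * ι (copies (just t) T)      ≤⟨ *-monoʳ (ι (k !)) (0≤ι (k !)) (copies≤density (just t) T (dens T N≤T)) ⟩
    ι (k !) * (q * ι ((‖ T ‖) C k))      ≡⟨ solve 3 (λ a b c → a :* (b :* c) := b :* (c :* a)) refl (ι (k !)) q (ι ((‖ T ‖) C k)) ⟩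
    q * (ι ((‖ T ‖) C k) * ι (k !))      ≡⟨ cong (q *_) (ι-* ((‖ T ‖) C k) (k !)) ⟨
    q * ι (((‖ T ‖) C k) ℕ.* k !)        ≤⟨ *-monoʳ q 0≤q (ι-mono (nCk*k!≤n^k (‖ T ‖) k)) ⟩
    q * ι (‖ T ‖ ℕ.^ k)                  ∎
    where
    open ℚ.≤-Reasoning
    k = leaves t

  -- The alternatives are the complement of the situation in `some-small-branch`. With at most one
  -- leaf, every rational above the inducibility is at least 1, and no threshold is required.
  branch-bound : 2 ℕ.≤ d → ∀ (B : Tree d) {q} → cut (inducibility B) q →
                 ∃ λ N → ∀ T → ‖ B ‖ ℕ.≤ 1 ⊎ N ℕ.< ‖ T ‖ →
                 ι (‖ B ‖ !) * ι (copies B T) ≤ q * ι (‖ T ‖ ℕ.^ ‖ B ‖)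
  branch-bound 2≤d nothing I<q = 0 , λ T _ → copies-≤1 nothing T z≤n (fromℚ<fromℚ⇒≤ (proj₂ I<q))
  branch-bound 2≤d B@(just leaf) I<q = 0 , λ T _ → copies-≤1 B T (s≤s z≤n) (1≤cut-inducibility-leaf 2≤d I<q)
  branch-bound 2≤d B@(just t@(node _ _ _)) I<q with N , dens ← cut-inducibility⇒density≤ t I<q = N , λ where
    T (inj₁ ‖B‖≤1) → contradiction (leaves≡1⇒leaf t (ℕ.≤-antisym ‖B‖≤1 (1≤leaves t))) λ ()
    T (inj₂ N<T)   → copies-large t (ℚ.<⇒≤ ([0,∞].positive (inducibility B) I<q)) dens T (ℕ.<⇒≤ N<T)

  -- By the definition of `_*∞_`, a rational above a product carries rationals above its factors;
  -- these become the constants c_i.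
  cut-∏∞ : ∀ (v : Fin n → [0,∞]) {q} → cut (∏∞ v) q →
           ∃ λ (c : Fin n → ℚ) → (∀ i → cut (v i) (c i)) × ∏ℚ c ≤ q
  cut-∏∞ {zero}  v (_ , 1<q) = (λ ()) , (λ ()) , fromℚ<fromℚ⇒≤ 1<q
  cut-∏∞ {suc n} v (a , b , v<a , ∏<b , ab<q) with c , v<c , ∏c≤b ← cut-∏∞ (v ∘ suc) ∏<b =
    (λ { zero → a ; (suc i) → c i }) , (λ { zero → v<a ; (suc i) → v<c i }) ,
    ℚ.≤-trans (*-monoʳ a (ℚ.<⇒≤ ([0,∞].positive (v zero) v<a)) ∏c≤b) (ℚ.<⇒≤ ab<q)

  abstract
    -- By `^≤P′+`, replacing the power by the falling factorial costs Q κ n^K, and (Q - A) n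
    -- eventually exceeds the constant B = e + Q κ.
    eventually-dominated : ∀ {A Q} K e → 0ℚ ≤ A → A < Q → 0ℚ ≤ e →
      ∃ λ N → ∀ n → N ℕ.≤ n → A * ι (n ℕ.^ suc K) + e * ι (n ℕ.^ K) ≤ Q * ι (n P′ suc K)
    eventually-dominated {A} {Q} K e 0≤A A<Q 0≤e = N , λ n N≤n →
      let u = ι (n ℕ.^ K)
          p = ι (n P′ suc K)
          lead : ι n * u ≤ p + κ * u
          lead = subst₂ _≤_ (ι-* n (n ℕ.^ K)) (trans (ι-+ (n P′ suc K) _) (cong (p +_) (ι-* (suc K ℕ.* suc K) (n ℕ.^ K))))
                   (ι-mono (^≤P′+ n K))
          B≤ : B * u ≤ (Q - A) * ι n * u
          B≤ = *-monoˡ u (0≤ι (n ℕ.^ K)) (ℚ.≤-trans B≤gN (*-monoʳ (Q - A) (ℚ.<⇒≤ (0<q-p A<Q)) (ι-mono N≤n)))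
      in subst (λ v → A * v + e * u ≤ Q * p) (sym (ι-* n (n ℕ.^ K)))
           (≤-by (Q * (p + κ * u - ι n * u) + ((Q - A) * ι n * u - B * u))
             (0≤+ (0≤* 0≤Q (0≤q-p lead)) (0≤q-p B≤))
             (solve 7 (λ A Q e κ p x u →
               (A :* (x :* u) :+ e :* u) :+ (Q :* (p :+ κ :* u :- x :* u) :+ ((Q :- A) :* x :* u :- (e :+ Q :* κ) :* u)) := Q :* p)
               refl A Q e κ p (ι n) u))
      where
      0≤Q : 0ℚ ≤ Q
      0≤Q = ℚ.≤-trans 0≤A (ℚ.<⇒≤ A<Q)
      κ B : ℚ
      κ = ι (suc K ℕ.* suc K)
      B = e + Q * κ
      η,gη≡ : ∃ λ η → 0ℚ < η × (Q - A) * η ≡ B + 1ℚ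
      -- The 1 is added because `quotient` requires a positive numerator, while B may vanish.
      η,gη≡ = quotient (0<q-p A<Q) (ℚ.+-mono-≤-< (0≤+ 0≤e (0≤* 0≤Q (0≤ι (suc K ℕ.* suc K)))) 0<1)
      N : ℕ
      N = proj₁ (archimedean (proj₁ η,gη≡))
      B≤gN : B ≤ (Q - A) * ι N
      B≤gN = ℚ.≤-trans (≤-by 1ℚ (ℚ.<⇒≤ 0<1) (sym (proj₂ (proj₂ η,gη≡))))
        (*-monoʳ (Q - A) (ℚ.<⇒≤ (0<q-p A<Q)) (proj₂ (archimedean (proj₁ η,gη≡))))

  multinomial-nonNeg : ∀ n (k : Fin d → ℕ) → 0ℚ ≤ multinomial n k
  multinomial-nonNeg n k = ℚ.nonNegative⁻¹ (multinomial n k)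
    {{ℚ.normalize-nonNeg (n !) (∏ (λ i → k i !)) {{product-nonZero _ (λ i → k i ℕ.!≢0)}}}}

  multinomial-*-∏! : ∀ n (k : Fin d → ℕ) → multinomial n k * ι (∏ (λ i → k i !)) ≡ ι (n !)
  multinomial-*-∏! n k = /-*-ι (n !) (∏ (λ i → k i !)) {{product-nonZero _ (λ i → k i ℕ.!≢0)}}

  -- Multiplication by ‖D‖! turns the binomial coefficient into a falling factorial, and the strict
  -- inequality between ‖D‖! A and F p leaves room for the lower-order term.
  copies⇒density : ∀ {K} (D : Tree d) → ‖ D ‖ ≡ suc K → ∀ F {A e p} → 0ℚ < F → 0ℚ ≤ A → 0ℚ ≤ e → 0ℚ ≤ p →
                   ι (‖ D ‖ !) * A < F * p →
                   (∀ T → F * ι (copies D T) ≤ A * ι (‖ T ‖ ℕ.^ suc K) + e * ι (‖ T ‖ ℕ.^ K)) →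
                   ∃ λ N → ∀ T → N ℕ.≤ ‖ T ‖ → density D T ≤ p
  copies⇒density {K = K} D ‖D‖≡ F {A} {e} {p} 0<F 0≤A 0≤e 0≤p A<p bound
    with N , dom ← eventually-dominated K (ι (‖ D ‖ !) * e) (0≤* (0≤ι (‖ D ‖ !)) 0≤A) A<p (0≤* (0≤ι (‖ D ‖ !)) 0≤e)
    = N ℕ.⊔ ‖ D ‖ , λ T N≤T → density≤ D T 0≤p (*-cancelʳ-≤ (0<* 0<F (0<ι (‖ D ‖ !) (ℕ.1≤n! (‖ D ‖)))) (begin
        ι (copies D T) * (F * f)
          ≡⟨ solve 3 (λ c F f → c :* (F :* f) := f :* (F :* c)) refl (ι (copies D T)) F f ⟩
        f * (F * ι (copies D T))
          ≤⟨ *-monoʳ f (0≤ι (‖ D ‖ !)) (bound T) ⟩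
        f * (A * ι (‖ T ‖ ℕ.^ suc K) + e * ι (‖ T ‖ ℕ.^ K))
          ≡⟨ solve 5 (λ f A u e v → f :* (A :* u :+ e :* v) := f :* A :* u :+ f :* e :* v) refl
               f A (ι (‖ T ‖ ℕ.^ suc K)) e (ι (‖ T ‖ ℕ.^ K)) ⟩
        f * A * ι (‖ T ‖ ℕ.^ suc K) + f * e * ι (‖ T ‖ ℕ.^ K)
          ≤⟨ dom (‖ T ‖) (ℕ.m⊔n≤o⇒m≤o N (‖ D ‖) N≤T) ⟩
        F * p * ι ((‖ T ‖) P′ suc K)
          ≡⟨ cong (λ k → F * p * ι ((‖ T ‖) P′ k)) ‖D‖≡ ⟨
        F * p * ι ((‖ T ‖) P′ (‖ D ‖))
          ≡⟨ cong (λ v → F * p * ι v) (nCk*k!≡nP′k (ℕ.m⊔n≤o⇒n≤o N (‖ D ‖) N≤T)) ⟨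
        F * p * ι (((‖ T ‖) C (‖ D ‖)) ℕ.* ‖ D ‖ !)
          ≡⟨ cong (F * p *_) (ι-* ((‖ T ‖) C (‖ D ‖)) (‖ D ‖ !)) ⟩
        F * p * (ι ((‖ T ‖) C (‖ D ‖)) * f)
          ≡⟨ solve 4 (λ F p b f → F :* p :* (b :* f) := p :* b :* (F :* f)) refl F p (ι ((‖ T ‖) C (‖ D ‖))) f ⟩
        p * ι ((‖ T ‖) C (‖ D ‖)) * (F * f) ∎))
    where
    open ℚ.≤-Reasoning
    f = ι (‖ D ‖ !)

  density-bound : 2 ℕ.≤ d → ∀ (D : Tree d) (2≤‖D‖ : 2 ℕ.≤ ‖ D ‖) (M : Representatives D)
                  (c : Fin d → ℚ) → (∀ i → cut (inducibility (branches D i)) (c i)) →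
                  ∀ {r} → 0ℚ ≤ r → (∀ x → Z D 2≤‖D‖ M x <ᴿ fromℚ r) →
                  ∀ {p} → 0ℚ ≤ p → multinomial ‖ D ‖ (λ i → ‖ branches D i ‖) * (∏ℚ c * r) < p →
                  ∃ λ N → ∀ T → N ℕ.≤ ‖ T ‖ → density D T ≤ p
  density-bound {d@(suc _)} 2≤d D 2≤‖D‖ M c I<c {r} 0≤r Z<r {p} 0≤p <p =
    copies⇒density D ‖D‖≡ (ι F) {A} {ι E} 0<F 0≤A (0≤ι E) 0≤p
      (subst (_< ι F * p) F*≡ (ℚ.*-monoʳ-<-pos (ι F) {{ℚ.positive 0<F}} <p)) copies-bound
    where
    ‖D‖≡ : ‖ D ‖ ≡ 2 ℕ.+ (‖ D ‖ ℕ.∸ 2)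
    ‖D‖≡ = sym (ℕ.m+[n∸m]≡n 2≤‖D‖)
    N : Fin d → ℕ
    N i = proj₁ (branch-bound 2≤d (branches D i) (I<c i))
    0≤c : ∀ i → 0ℚ ≤ c i
    0≤c i = ℚ.<⇒≤ ([0,∞].positive (inducibility (branches D i)) (I<c i))
    -- The sum of all thresholds serves as a common one, since it dominates each `N i`.
    branch≤ : ∀ i T → ‖ branches D i ‖ ℕ.≤ 1 ⊎ ∑ N ℕ.< ‖ T ‖ →
              ι (‖ branches D i ‖ !) * ι (copies (branches D i) T) ≤ c i * ι (‖ T ‖ ℕ.^ ‖ branches D i ‖)
    branch≤ i T = proj₂ (branch-bound 2≤d (branches D i) (I<c i)) T ∘ Sum.map₂ (ℕ.≤-<-trans (term≤∑ N i))
    Z≤ : ∀ (m : Fin d → ℕ) → (∀ j → m j ℕ.< ∑ m) →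
         ι (sum (List.map (λ π → ∏ (λ j → m j ℕ.^ ‖ branches D (π ⟨$⟩ʳ j) ‖)) (Representatives.list M))) ≤
         r * (ι (∑ m ℕ.^ ‖ D ‖) - ι (∑ (λ j → m j ℕ.^ ‖ D ‖)))
    Z≤ m m<∑m = Z-proportions m m<∑m 0<∑m D 2≤‖D‖ M (Z<r (proportions m m<∑m 0<∑m))
      where
      0<∑m : 0 ℕ.< ∑ m
      0<∑m = ℕ.≤-<-trans z≤n (m<∑m zero)
    open Bound D 2≤‖D‖ ‖D‖≡ M c 0≤c (∑ N) branch≤ r 0≤r Z≤
      using (F; E; A; 0≤A; copies-bound)
    μ = multinomial ‖ D ‖ (λ i → ‖ branches D i ‖)
    0<F : 0ℚ < ι F
    0<F = 0<ι F (1≤∏ (λ i → ℕ.1≤n! (‖ branches D i ‖)))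
    F*≡ : ι F * (μ * A) ≡ ι (‖ D ‖ !) * A
    F*≡ = trans (solve 3 (λ f μ a → f :* (μ :* a) := μ :* f :* a) refl (ι F) μ A)
      (cong (_* A) (multinomial-*-∏! ‖ D ‖ (λ i → ‖ branches D i ‖)))

open import Data.Maybe.Base using (just)
open import Data.Nat.Base using (ℕ; _≤_)
open import Data.Product.Base using (_,_; proj₂)
import Data.Rational.Properties as ℚ
open import Relation.Binary.PropositionalEquality using (sym)
open Rationals
open Limit

proposition3 :
    ∀ (d : ℕ) → 2 ≤ d →
    ∀ (D : Tree d) (2≤‖D‖ : 2 ≤ ‖ D ‖) (M : Representatives D) →
    inducibility D ≤∞
      upperℚ (multinomial ‖ D ‖ (λ i → ‖ branches D i ‖))
        *∞ ∏∞ (λ i → inducibility (branches D i))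
        *∞ ⨆ (λ (x : Simplex d) → upper (Z D 2≤‖D‖ M x))
proposition3 d 2≤d D@(just t) 2≤‖D‖ M
  (a , b , (a₁ , b₁ , μ<a₁ , ∏<b₁ , a₁b₁<a) , (r , 0<r , r<b , Z<r) , ab<q) =
  let μ = multinomial ‖ D ‖ (λ i → ‖ branches D i ‖)
      c , I<c , ∏c≤b₁ = cut-∏∞ (λ i → inducibility (branches D i)) ∏<b₁
      -- Strictness is needed on both sides of `p`: below it to absorb the lower-order term, above
      -- it to pass through the suprema in the inducibility.
      p , ab<p , p<q = ℚ.<-dense ab<q
      0≤r = ℚ.<⇒≤ 0<r
      0≤μ = multinomial-nonNeg ‖ D ‖ (λ i → ‖ branches D i ‖)
      0≤∏c = 0≤∏ℚ (λ i → ℚ.<⇒≤ ([0,∞].positive (inducibility (branches D i)) (I<c i)))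
      μ∏c≤a = ℚ.≤-trans (*-mono 0≤μ (fromℚ<fromℚ⇒≤ (proj₂ μ<a₁)) 0≤∏c ∏c≤b₁) (ℚ.<⇒≤ a₁b₁<a)
      μ∏cr≤ab = *-mono (0≤* 0≤μ 0≤∏c) μ∏c≤a 0≤r (ℚ.<⇒≤ r<b)
      μ∏cr<p = ℚ.≤-<-trans (ℚ.≤-trans (ℚ.≤-reflexive (sym (ℚ.*-assoc μ (∏ℚ c) r))) μ∏cr≤ab) ab<p
      0≤p = ℚ.<⇒≤ (ℚ.≤-<-trans (0≤* 0≤μ (0≤* 0≤∏c 0≤r)) μ∏cr<p)
      N , dens = density-bound 2≤d D 2≤‖D‖ M c I<c 0≤r (λ x → proj₂ (Z<r x)) 0≤p μ∏cr<p
  in density≤⇒cut-inducibility t 0≤p p<q N dens
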